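{- The message complexity of the Distributed Balanced Color Assignment Problem with $n$ agents and $m\ge n$ colors on a ring is $\Omega(mn)$, for both synchronous and asynchronous rings. That is, any distributed algorithm that solves the problem on rings of $n$ agents with $m$ colors requires, in the worst case, the transmission of $\Omega(mn)$ basic messages.
   Context: Problem. There are $n$ agents $a_0,\dots,a_{n-1}$ connected by a ring and $m$ colors $c_0,\dots,c_{m-1}$. The integer $Q_{j,i}\ge 0$ is the number of items of color $c_j$ initially held by agent $a_i$. A Balanced Coloring is an assignment $\pi:\{0,\dots,m-1\}\to\{0,\dots,n-1\}$ of colors to agents ($c_j$ is assigned to $a_{\pi(j)}$) such that every agent receives between $\lfloor m/n\rfloor$ and $\lceil m/n\rceil$ colors; in particular $\lfloor m/n\rfloor$ colors are assigned to $(\lfloor m/n\rfloor+1)n-m$ agents and $\lfloor m/n\rfloor+1$ colors to the remaining $m-\lfloor m/n\rfloor n$ agents. Its cost is $Cost(\pi)=\sum_{j=0}^{m-1}\sum_{i\ne\pi(j)}Q_{j,i}$. The Distributed Balanced Color Assignment Problem asks to find distributively a Balanced Coloring of minimum cost; at the end each agent must know the colors assigned to it. Model. Agent $a_i$ can communicate only with its two neighbors $a_{(i+1)\bmod n}$ and $a_{(i-1)\bmod n}$. Each agent knows $n$, the set of colors, and its own quantities $Q_{j,i}$. In the synchronous model there is a global clock and computation proceeds in rounds; in each round an agent may check for a message sent in the previous round, compute locally, and send a message. In the asynchronous model there is no global clock, computation is event driven, and messages arrive after a finite but unbounded time. Message complexity: a basic message is a message of at most $c\log n$ bits ($c$ a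 constant), and its transmission over one link has unit cost; a message of $L$ bits costs $c'\lceil L/\log n\rceil$ ($c'$ a constant) per link traversed.
   Formalization: For synchronous rings the number of rounds is assumed at most (n + m + total number of items)^d, the constant in Ω(mn) depending on d; with unlimited rounds the claim fails, since delays between empty messages can encode all data in O(n) messages. -}

module Defs where

open import Algebra.Properties.Monoid.Sum using (sum)
open import Data.Bool.Base using (Bool; if_then_else_)
open import Data.Fin.Base using (Fin; zero; suc; toℕ; opposite)
open import Data.Fin.Properties using (_≟_)
open import Data.Fin.Subset using (Subset; ∣_∣)
open import Data.List.Base as List using (List; []; _∷_; _++_; length)
open import Data.Maybe using (Maybe; just; nothing; maybe′; Is-just)
open import Data.Nat.Base
open import Data.Nat.DivMod using (_/_; _mod_)
open import Data.Nat.ListAction using () renaming (sum to sumˡ)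
open import Data.Nat.Logarithm using (⌈log₂_⌉; ⌈log₂⌉-mono-≤)
open import Data.Nat.Properties using (+-0-monoid; m*n≢0; ≤-trans; ≤-refl)
open import Data.Product.Base using (_×_; _,_; ∃; ∃-syntax; proj₁; proj₂)
open import Data.Vec.Base as Vec using (Vec; lookup)
open import Data.Vec.Functional using (updateAt)
open import Function.Base using (const)
open import Relation.Binary.PropositionalEquality.Core using (_≡_)
open import Relation.Nullary.Decidable.Core using (does)

∑ : ∀ {k} → (Fin k → ℕ) → ℕ
∑ = sum +-0-monoid

⌈_/_⌉ : (a b : ℕ) .{{_ : NonZero b}} → ℕ
⌈ a / b ⌉ = (a + pred b) / b

------------------------------------------------------------------------
-- Balanced colorings

-- The number Q_{j,i} of items of color j held by agent i is lookup (Q i) j;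
-- Q i is all that agent i knows of the instance.
Instance : (n m : ℕ) → Set
Instance n m = Fin n → Vec ℕ m

Assignment : (n m : ℕ) → Set
Assignment n m = Fin m → Fin n

module _ {n m : ℕ} where

  totalItems : Instance n m → ℕ
  totalItems Q = ∑ λ j → ∑ λ i → lookup (Q i) j

  cost : Instance n m → Assignment n m → ℕ
  cost Q π = ∑ λ j → ∑ λ i → if does (i ≟ π j) then 0 else lookup (Q i) j

  colorsOf : Assignment n m → Fin n → Subset m
  colorsOf π i = Vec.tabulate λ j → does (π j ≟ i)

  module _ .{{_ : NonZero n}} where

    Balanced : Assignment n m → Set
    Balanced π = ∀ i → m / n ≤ ∣ colorsOf π i ∣ × ∣ colorsOf π i ∣ ≤ ⌈ m / n ⌉

    Optimal : Instance n m → Assignment n m → Set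
    Optimal Q π = Balanced π × (∀ ρ → Balanced ρ → cost Q π ≤ cost Q ρ)

    -- A decision of an agent is the set of colors it believes it is assigned,
    -- or nothing while it does not know yet.
    Correct : Instance n m → (Fin n → Maybe (Subset m)) → Set
    Correct Q decision =
      ∃[ π ] Optimal Q π × (∀ i → decision i ≡ just (colorsOf π i))

AllDecided : ∀ {n m} → (Fin n → Maybe (Subset m)) → Set
AllDecided decision = ∀ i → Is-just (decision i)

------------------------------------------------------------------------
-- The ring

Side : Set
Side = Fin 2

pattern left  = zero
pattern right = suc zero

-- For n = 2 both neighbours are the same agent, reached over two distinct
-- links. A message sent by i towards side d arrives at neighbour d i on side
-- opposite d.
neighbour : ∀ {n} .{{_ : NonZero n}} → Side → Fin n → Fin n
neighbour {n} left  i = (toℕ i + pred n) mod n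
neighbour {n} right i = suc (toℕ i) mod n

Message : Set
Message = List Bool

private
  log≢0 : ∀ n → .{{NonTrivial n}} → NonZero ⌈log₂ n ⌉
  log≢0 n = >-nonZero (≤-trans (≤-refl {1}) (⌈log₂⌉-mono-≤ {2} {n} (nonTrivial⇒n>1 n)))

  capacity≢0 : ∀ c n .{{_ : NonZero c}} .{{_ : NonTrivial n}} → NonZero (c * ⌈log₂ n ⌉)
  capacity≢0 c n = m*n≢0 c ⌈log₂ n ⌉
    where instance _ = log≢0 n

-- The number of basic messages, of at most c log n bits each, that a message
-- is worth. An empty message still has to be transmitted.
basicMessages : (c n : ℕ) .{{_ : NonZero c}} .{{_ : NonTrivial n}} → Message → ℕ
basicMessages c n msg =
  1 ⊔ ⌈ length msg / c * ⌈log₂ n ⌉ ⌉ {{capacity≢0 c n}}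

------------------------------------------------------------------------
-- Synchronous rings

-- The code of an agent may depend on n, m and the agent's position in the ring.
-- Decisions are irrevocable, but an agent that has decided may go on relaying
-- messages.
record SyncAlgorithm (n m : ℕ) : Set₁ where
  field
    State    : Set
    start    : Fin n → Vec ℕ m → State
    step     : Fin n → State → (fromLeft fromRight : Maybe Message) →
               State × (Side → Maybe Message)
    decision : State → Maybe (Subset m)
    final    : ∀ i s l r {S} → decision s ≡ just S →
               decision (proj₁ (step i s l r)) ≡ just S

module Sync {n m : ℕ} .{{_ : NonTrivial n}} (A : SyncAlgorithm n m) where
  open SyncAlgorithm A

  private instance
    n≢0 : NonZero n
    n≢0 = nonTrivial⇒nonZero n

  record Config : Set where
    field
      state : Fin n → State
      sent  : Fin n → Side → Maybe Message   -- in the last round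
  open Config public

  initial : Instance n m → Config
  initial Q = record { state = λ i → start i (Q i) ; sent = λ _ _ → nothing }

  received : Config → Fin n → Side → Maybe Message
  received C i d = sent C (neighbour d i) (opposite d)

  round : Config → Config
  round C = record { state = λ i → proj₁ (next i) ; sent = λ i → proj₂ (next i) }
    where
    next : Fin n → State × (Side → Maybe Message)
    next i = step i (state C i) (received C i left) (received C i right)

  run : Instance n m → ℕ → Config
  run Q zero    = initial Q
  run Q (suc t) = round (run Q t)

  decisions : Config → Fin n → Maybe (Subset m)
  decisions C i = decision (state C i)

  messagesSent : (c : ℕ) .{{_ : NonZero c}} → Instance n m → ℕ → ℕ
  messagesSent c Q zero    = 0
  messagesSent c Q (suc t) = messagesSent c Q t +
    ∑ λ i → ∑ λ d → maybe′ (basicMessages c n) 0 (sent (run Q (suc t)) i d)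

  -- The running time is polynomial in n, m and the number of items. Some bound
  -- is needed: if the number of rounds is unrestricted, an agent can convey
  -- all it knows to a neighbour by two empty messages, the delay between them
  -- encoding the data, and O(n) messages suffice whatever m is.
  SolvesInTime : (d : ℕ) → Set
  SolvesInTime d = ∀ Q →
    (∃[ t ] t ≤ (n + m + totalItems Q) ^ d × AllDecided (decisions (run Q t))) ×
    (∀ t → AllDecided (decisions (run Q t)) → Correct Q (decisions (run Q t)))

------------------------------------------------------------------------
-- Asynchronous rings

record AsyncAlgorithm (n m : ℕ) : Set₁ where
  field
    State    : Set
    start    : Fin n → Vec ℕ m → State × (Side → List Message)
    react    : Fin n → State → (from : Side) → Message →
               State × (Side → List Message)
    decision : State → Maybe (Subset m)
    final    : ∀ i s d msg {S} → decision s ≡ just S →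
               decision (proj₁ (react i s d msg)) ≡ just S

module Async {n m : ℕ} .{{_ : NonTrivial n}} (A : AsyncAlgorithm n m) where
  open AsyncAlgorithm A

  private instance
    n≢0 : NonZero n
    n≢0 = nonTrivial⇒nonZero n

  record Config : Set where
    field
      state       : Fin n → State
      queue       : Fin n → Side → List Message   -- in transit to i from side d
      transmitted : List Message                  -- all messages sent so far
  open Config public

  initial : Instance n m → Config
  initial Q = record
    { state       = λ i → proj₁ (start i (Q i))
    ; queue       = λ i d → out (neighbour d i) (opposite d)
    ; transmitted = List.concat (List.tabulate λ i → List.concat (List.tabulate (out i)))
    }
    where
    out : Fin n → Side → List Message
    out i = proj₂ (start i (Q i))

  Event : Set
  Event = Fin n × Side

  -- Delivery of the first message in transit to i from side d, if there is one.
  deliver : Event → Config → Config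
  deliver (i , d) C with queue C i d
  ... | []       = C
  ... | msg ∷ ms = record
    { state       = updateAt (state C) i (const (proj₁ next))
    ; queue       = λ k e → remaining k e ++
                    (if does (neighbour e k ≟ i) then out (opposite e) else [])
    ; transmitted = transmitted C ++ List.concat (List.tabulate out)
    }
    where
    next : State × (Side → List Message)
    next = react i (state C i) d msg
    out : Side → List Message
    out = proj₂ next
    remaining : Fin n → Side → List Message
    remaining = updateAt (queue C) i λ q → updateAt q d (const ms)

  Schedule : Set
  Schedule = ℕ → Event

  -- Every message is delivered after a finite, but unbounded, delay.
  Fair : Schedule → Set
  Fair σ = ∀ e t → ∃[ t′ ] t ≤ t′ × σ t′ ≡ e

  run : Instance n m → Schedule → ℕ → Config
  run Q σ zero    = initial Q
  run Q σ (suc t) = deliver (σ t) (run Q σ t)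

  decisions : Config → Fin n → Maybe (Subset m)
  decisions C i = decision (state C i)

  messagesSent : (c : ℕ) .{{_ : NonZero c}} → Config → ℕ
  messagesSent c C = sumˡ (List.map (basicMessages c n) (transmitted C))

  Solves : Set
  Solves = ∀ Q σ → Fair σ →
    (∃[ t ] AllDecided (decisions (run Q σ t))) ×
    (∀ t → AllDecided (decisions (run Q σ t)) → Correct Q (decisions (run Q σ t)))

------------------------------------------------------------------------
-- Worst-case lower bounds

-- On some input (and schedule), at least m n / K basic messages have been sent
-- whenever the computation is over.

module _ {n m : ℕ} .{{_ : NonTrivial n}} (c : ℕ) .{{_ : NonZero c}} (K : ℕ) where

  SyncRequires : SyncAlgorithm n m → Set
  SyncRequires A = ∃[ Q ] (∀ t → AllDecided (decisions (run Q t)) →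
                           m * n ≤ K * messagesSent c Q t)
    where open Sync A

  AsyncRequires : AsyncAlgorithm n m → Set
  AsyncRequires A = ∃[ Q ] ∃[ σ ] Fair σ ×
                    (∀ t → AllDecided (decisions (run Q σ t)) →
                     m * n ≤ K * messagesSent c (run Q σ t))
    where open Async A

{-# OPTIONS --safe #-}

-- Every agent at distance more than r from agent 0 owns some contested colors:
-- the owner of the k-th one holds 2 α k + 2 items of it, and agent 0 holds
-- 2 α k + 1, so that every optimal coloring gives the color to its owner. There
-- are r + 1 nested arcs around agent 0's antipode that contain all owners but
-- not agent 0. If the messages that cross the boundary of one of them are the
-- same for α and for β, then when the owners hold α and agent 0 holds β, the
-- owners still claim their colors, which is wrong if α k < β k for some k. So,
-- for the arc whose boundary is crossed by the fewest messages, this traffic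
-- must determine α. The boundaries are disjoint, so that the whole run costs
-- r + 1 = Ω(n) times as much as the encoding of a vector of p = Ω(m) numbers of
-- v bits, at O(v) bits for each basic message.
--
-- In a synchronous ring the time of a message carries information too, but only
-- O(log m) bits if the running time is polynomial; v is chosen of that order.
-- In an asynchronous ring two executions with the same traffic across a boundary
-- can be merged by interleaving their deliveries.

module Submission where

open import Algebra.Properties.CommutativeMonoid.Sum using (sum-permute; ∑-distrib-+; ∑-comm)
open import Algebra.Properties.Monoid.Sum using (sum-cong-≗)
open import Data.Bool.Base using (Bool; true; false; not; if_then_else_)
import Data.Bool.Properties as Bool
open import Data.Empty using (⊥-elim)
open import Data.Fin.Base using (Fin; zero; suc; toℕ; fromℕ<; opposite; _↑ˡ_; _↑ʳ_;
  combine; remQuot; splitAt; inject≤; cast; finToFun; funToFin)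
open import Data.Fin.Permutation using (Permutation′; _⟨$⟩ʳ_; transpose; permutation)
import Data.Fin.Permutation.Components as PC
open import Data.Fin.Properties using (_≟_; all?; any?; pigeonhole; ¬∀⟶∃¬; toℕ-injective; toℕ<n;
  toℕ-fromℕ<; toℕ-↑ˡ; toℕ-↑ʳ; toℕ-cast; toℕ-inject≤; splitAt-↑ˡ; splitAt-↑ʳ; splitAt⁻¹-↑ˡ;
  splitAt⁻¹-↑ʳ; combine-injective; remQuot-combine; combine-remQuot; funToFin-finToFin)
open import Data.Fin.Subset using (Subset; ∣_∣)
open import Data.List.Base as List using (List; []; _∷_; _++_; _∷ʳ_; filter; foldr; length; concat)
open import Data.List.Membership.Propositional using (_∈_)
open import Data.List.Membership.Propositional.Properties
open import Data.List.Properties using (∷-injective; ∷-injectiveʳ; ∷ʳ-injective; ++-assoc; ++-identityʳ;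
  ++-conicalʳ; length-++; map-++; filter-++; filter-accept; filter-reject)
open import Data.List.Relation.Unary.All as All using (All; []; _∷_)
open import Data.List.Relation.Unary.All.Properties using (filter⁺; ++⁺)
open import Data.List.Relation.Unary.Any using (here; there)
open import Data.Maybe as Maybe using (Maybe; just; nothing; maybe′; Is-just)
open import Data.Maybe.Properties using (just-injective)
import Data.Maybe.Relation.Unary.Any as Maybeᴬ
open import Data.Nat.Base
open import Data.Nat.DivMod
open import Data.Nat.Induction using (<-rec)
open import Data.Nat.ListAction using () renaming (sum to sumˡ)
open import Data.Nat.ListAction.Properties using (sum-++)
open import Data.Nat.Logarithm
open import Data.Nat.Properties hiding (_≟_)
import Data.Nat.Properties as ℕ
open import Data.Nat.Tactic.RingSolver using (solve-∀)
open import Data.Product.Base using (_×_; _,_; ∃-syntax; ∃₂; proj₁; proj₂)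
open import Data.Sum.Base using (_⊎_; inj₁; inj₂)
open import Data.Unit.Base using (⊤; tt)
open import Data.Vec.Base as Vec using (lookup)
open import Data.Vec.Functional using (updateAt)
open import Data.Vec.Functional.Properties using (updateAt-updates; updateAt-minimal)
open import Data.Vec.Properties using (lookup∘tabulate; tabulate-cong)
open import Function.Base using (_∘_; const; it)
open import Relation.Binary.Definitions using (tri<; tri≈; tri>)
open import Relation.Binary.PropositionalEquality
open import Relation.Nullary using (¬_; Dec; does; yes; no; contradiction; ¬?; _×-dec_)
open import Relation.Nullary.Decidable using (dec-true; dec-false)
open import Relation.Unary using (Decidable)
open import Defs

-- Sums

-- The inputs on which the owners and agent 0 hold the same vector form a fooling set: two different
-- vectors differ at some color, and the one that is smaller there is given to the owners. Odd
-- against even item counts exclude ties, so neither order of the two is special.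
--
-- The counting uses prefix codes. A run is keyed by its cheapest cut, which varies with the input,
-- and by the traffic across it; keys shorter than `v * p` bits must collide on `2 ^ (v * p)`
-- inputs. The fixed part of a key has to fit into `v * p` bits as well. With a synchronous stopping
-- time in it, this may fail for few colors, which therefore need an argument of their own.
--
-- The models differ in when two runs can be compared. In a synchronous ring silence is information,
-- so colliding runs must have equal length; the mixed run may go on longer, and irrevocable
-- decisions bridge the gap. In an asynchronous ring only delivered messages count, the two runs may
-- stop at different moments, and the merged configuration is already complete.

∑-cong : ∀ {k} {f g : Fin k → ℕ} → (∀ i → f i ≡ g i) → ∑ f ≡ ∑ g
∑-cong = sum-cong-≗ +-0-monoid

∑-mono-≤ : ∀ {k} {f g : Fin k → ℕ} → (∀ i → f i ≤ g i) → ∑ f ≤ ∑ g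
∑-mono-≤ {zero}  le = z≤n
∑-mono-≤ {suc k} le = +-mono-≤ (le zero) (∑-mono-≤ (le ∘ suc))

∑-mono-< : ∀ {k} {f g : Fin k → ℕ} → (∀ i → f i ≤ g i) → ∀ i → f i < g i → ∑ f < ∑ g
∑-mono-< le zero    lt = +-mono-<-≤ lt (∑-mono-≤ (le ∘ suc))
∑-mono-< le (suc i) lt = +-mono-≤-< (le zero) (∑-mono-< (le ∘ suc) i lt)

∑-bounded : ∀ {k} {f : Fin k → ℕ} {b} → (∀ i → f i ≤ b) → ∑ f ≤ k * b
∑-bounded {zero}  le = z≤n
∑-bounded {suc k} le = +-mono-≤ (le zero) (∑-bounded (le ∘ suc))

∑-zero : ∀ k → ∑ {k} (λ _ → 0) ≡ 0
∑-zero zero    = refl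
∑-zero (suc k) = ∑-zero k

∑-+ : ∀ {k} (f g : Fin k → ℕ) → ∑ (λ i → f i + g i) ≡ ∑ f + ∑ g
∑-+ = ∑-distrib-+ +-0-commutativeMonoid

∑-↑ : ∀ a {b} (f : Fin (a + b) → ℕ) → ∑ f ≡ ∑ (λ i → f (i ↑ˡ b)) + ∑ (λ i → f (a ↑ʳ i))
∑-↑ zero    f = refl
∑-↑ (suc a) f = trans (cong (f zero +_) (∑-↑ a (f ∘ suc))) (sym (+-assoc (f zero) _ _))

∑-combine : ∀ a {b} (f : Fin (a * b) → ℕ) → ∑ f ≡ ∑ {a} λ x → ∑ {b} λ u → f (combine x u)
∑-combine zero        f = refl
∑-combine (suc a) {b} f = trans (∑-↑ b f)
  (cong (∑ (λ u → f (u ↑ˡ (a * b))) +_) (∑-combine a (λ i → f (b ↑ʳ i))))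

∑-except : ∀ {k} (f : Fin k → ℕ) x → ∑ (λ i → if does (i ≟ x) then 0 else f i) + f x ≡ ∑ f
∑-except {suc k} f zero    = +-comm (∑ (f ∘ suc)) (f zero)
∑-except {suc k} f (suc x) = trans (+-assoc (f zero) _ _) (cong (f zero +_) (∑-except (f ∘ suc) x))

-- The position `a` is a natural number that may lie out of range: the level of a link can exceed
-- that of every cut.
∑-at-most-one : ∀ {k} (b : Fin k → Bool) a w → (∀ i → b i ≡ true → toℕ i ≡ a) →
                ∑ (λ i → if b i then w else 0) ≤ w
∑-at-most-one {zero}  b a w only = z≤n
∑-at-most-one {suc k} b a w only with b zero in eq
... | true  = begin
  w + ∑ (λ i → if b (suc i) then w else 0) ≡⟨ cong (w +_) (∑-cong (λ i → cong (if_then w else 0) (rest i))) ⟩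
  w + ∑ {k} (λ i → 0)                      ≡⟨ cong (w +_) (∑-zero k) ⟩
  w + 0                                    ≡⟨ +-identityʳ w ⟩
  w                                        ∎
  where
  open ≤-Reasoning
  rest : ∀ i → b (suc i) ≡ false
  rest i with b (suc i) in eq′
  ... | false = refl
  ... | true  = contradiction (trans (only (suc i) eq′) (sym (only zero eq))) λ ()
... | false = ∑-at-most-one (b ∘ suc) (pred a) w λ i eq′ → cong pred (only (suc i) eq′)

∑-indicator : ∀ {k} (x : Fin k) → ∑ (λ i → if does (i ≟ x) then 1 else 0) ≡ 1
∑-indicator {suc k} zero    = cong suc (∑-zero k)
∑-indicator {suc k} (suc x) = ∑-indicator x

size-tabulate : ∀ {k} (b : Fin k → Bool) → ∣ Vec.tabulate b ∣ ≡ ∑ λ j → if b j then 1 else 0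
size-tabulate {zero}  b = refl
size-tabulate {suc k} b with b zero
... | true  = cong suc (size-tabulate (b ∘ suc))
... | false = size-tabulate (b ∘ suc)

least : ∀ {P : ℕ → Set} → (∀ t → Dec (P t)) → ∀ t → P t →
        ∃[ u ] u ≤ t × P u × (∀ s → P s → u ≤ s)
least P? t p with P? 0
... | yes p₀ = 0 , z≤n , p₀ , λ _ _ → z≤n
least P? zero    p | no ¬p₀ = contradiction p ¬p₀
least {P} P? (suc t) p | no ¬p₀ with least (P? ∘ suc) t p
... | u , u≤t , pu , min = suc u , s≤s u≤t , pu , λ where
  zero    p₀ → contradiction p₀ ¬p₀
  (suc s) ps → s≤s (min s ps)

-- Optimal colorings

module _ {n m : ℕ} where

  -- The items that need not move. As cost and gain have a constant sum, optimality can be refuted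
  -- by comparing gains color by color.
  gain : Instance n m → Assignment n m → ℕ
  gain Q π = ∑ λ j → lookup (Q (π j)) j

  cost+gain : ∀ (Q : Instance n m) π → cost Q π + gain Q π ≡ totalItems Q
  cost+gain Q π = trans (sym (∑-+ _ (λ j → lookup (Q (π j)) j)))
    (∑-cong λ j → ∑-except (λ i → lookup (Q i) j) (π j))

  module _ .{{_ : NonZero n}} where

    optimal-not-improvable : ∀ (Q : Instance n m) π ρ → Optimal Q π → Balanced ρ →
      (∀ j → lookup (Q (π j)) j ≤ lookup (Q (ρ j)) j) →
      ∀ j → ¬ lookup (Q (π j)) j < lookup (Q (ρ j)) j
    optimal-not-improvable Q π ρ (_ , best) balanced le j lt =
      <-irrefl (trans (cost+gain Q π) (sym (cost+gain Q ρ)))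
        (+-mono-≤-< (best ρ balanced) (∑-mono-< le j lt))

    balanced-∘ : ∀ (π : Assignment n m) (τ : Permutation′ m) → Balanced π → Balanced (π ∘ (τ ⟨$⟩ʳ_))
    balanced-∘ π τ balanced i =
      subst (λ size → m / n ≤ size × size ≤ ⌈ m / n ⌉) size-∘ (balanced i)
      where
      size-∘ : ∣ colorsOf π i ∣ ≡ ∣ colorsOf (π ∘ (τ ⟨$⟩ʳ_)) i ∣
      size-∘ = trans (size-tabulate (λ j → does (π j ≟ i))) (trans
        (sum-permute +-0-commutativeMonoid (λ j → if does (π j ≟ i) then 1 else 0) τ)
        (sym (size-tabulate (λ j → does (π (τ ⟨$⟩ʳ j) ≟ i)))))

colorsOf-injective : ∀ {n m} (π ρ : Assignment n m) i → colorsOf π i ≡ colorsOf ρ i →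
                     ∀ j → ρ j ≡ i → π j ≡ i
colorsOf-injective π ρ i eq j ρj≡i with π j ≟ i in π?
... | yes πj≡i = πj≡i
... | no  _    = contradiction contra λ ()
  where
  contra : false ≡ true
  contra = begin
    false                         ≡⟨ cong does π? ⟨
    does (π j ≟ i)                ≡⟨ lookup∘tabulate (λ j → does (π j ≟ i)) j ⟨
    lookup (colorsOf π i) j       ≡⟨ cong (λ p → lookup p j) eq ⟩
    lookup (colorsOf ρ i) j       ≡⟨ lookup∘tabulate (λ j → does (ρ j ≟ i)) j ⟩
    does (ρ j ≟ i)                ≡⟨ dec-true (ρ j ≟ i) ρj≡i ⟩
    true                          ∎
    where open ≡-Reasoning

-- Every contested color, i.e. one with a slot k, is held by two agents only: its
-- owner has 2 α k + 2 items of it and the rival 2 β k + 1, so that the owner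
-- outbids the rival exactly if β k ≤ α k.
module Contest {n m p : ℕ} .{{_ : NonZero n}}
  (owner : Assignment n m) (balanced : Balanced owner)
  (slot : Fin m → Maybe (Fin p)) (color : Fin p → Fin m) (slot-color : ∀ k → slot (color k) ≡ just k)
  (rival : Fin n) (spare : Fin m) (owner-spare : owner spare ≡ rival)
  (owner≢rival : ∀ {j k} → slot j ≡ just k → owner j ≢ rival)
  where

  items : (α β : Fin p → ℕ) → Fin n → Fin m → ℕ
  items α β i j = maybe′ (λ k → if does (i ≟ owner j) then 2 * α k + 2 else
                                if does (i ≟ rival) then 2 * β k + 1 else 0) 0 (slot j)

  contest : (α β : Fin p → ℕ) → Instance n m
  contest α β i = Vec.tabulate (items α β i)

  module _ (α β : Fin p → ℕ) where

    lookup-contest : ∀ i j → lookup (contest α β i) j ≡ items α β i j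
    lookup-contest i j = lookup∘tabulate (items α β i) j

    items-uncontested : ∀ i {j} → slot j ≡ nothing → items α β i j ≡ 0
    items-uncontested i none rewrite none = refl

    items-owner : ∀ {j k} → slot j ≡ just k → items α β (owner j) j ≡ 2 * α k + 2
    items-owner {j} some rewrite some | dec-true (owner j ≟ owner j) refl = refl

    items-rival : ∀ {j k} → slot j ≡ just k → items α β rival j ≡ 2 * β k + 1
    items-rival {j} some rewrite some
      | dec-false (rival ≟ owner j) (owner≢rival some ∘ sym) | dec-true (rival ≟ rival) refl = refl

    items-≤ : ∀ {b} → (∀ k → α k ≤ b) → (∀ k → β k ≤ b) → ∀ i j → items α β i j ≤ 2 * b + 2
    items-≤ {b} α≤b β≤b i j with slot j
    ... | nothing = z≤n
    ... | just k with does (i ≟ owner j) | does (i ≟ rival)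
    ...   | true  | _     = +-monoˡ-≤ 2 (*-monoʳ-≤ 2 (α≤b k))
    ...   | false | true  = +-mono-≤ (*-monoʳ-≤ 2 (β≤b k)) (s≤s z≤n)
    ...   | false | false = z≤n

    contest-not-improvable : ∀ π ρ → Optimal (contest α β) π → Balanced ρ →
      (∀ j → items α β (π j) j ≤ items α β (ρ j) j) →
      ∀ j → ¬ items α β (π j) j < items α β (ρ j) j
    contest-not-improvable π ρ optimal balanced-ρ le j lt =
      optimal-not-improvable (contest α β) π ρ optimal balanced-ρ
        (λ j → subst₂ _≤_ (sym (lookup-contest (π j) j)) (sym (lookup-contest (ρ j) j)) (le j)) j
        (subst₂ _<_ (sym (lookup-contest (π j) j)) (sym (lookup-contest (ρ j) j)) lt)

  total-contest : ∀ {α b} → (∀ k → α k ≤ b) → totalItems (contest α α) ≤ m * (n * (2 * b + 2))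
  total-contest {α} {b} α≤b = ∑-bounded λ j → ∑-bounded λ i →
    subst (_≤ 2 * b + 2) (sym (lookup-contest α α i j)) (items-≤ α α α≤b α≤b i j)

  -- Only the rival sees `β`, and by `contest-unowned` only owners see `α`. So across a cut between
  -- them the mixed instance looks to each agent like one of the two matched ones.
  contest-away : ∀ {α β β′ i} → i ≢ rival → contest α β i ≡ contest α β′ i
  contest-away {α} {β} {β′} {i} i≢rival = tabulate-cong λ j → same j
    where
    same : ∀ j → items α β i j ≡ items α β′ i j
    same j rewrite dec-false (i ≟ rival) i≢rival = refl

  contest-unowned : ∀ {α α′ β i} → (∀ {j k} → slot j ≡ just k → owner j ≢ i) →
                    contest α β i ≡ contest α′ β i
  contest-unowned {α} {α′} {β} {i} unowned = tabulate-cong same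
    where
    same : ∀ j → items α β i j ≡ items α′ β i j
    same j with slot j in eq
    ... | nothing = refl
    ... | just k rewrite dec-false (i ≟ owner j) (unowned eq ∘ sym) = refl

  -- With equal vectors the owner of a contested color is its largest holder, and uncontested colors
  -- have no items. Hence replacing `π` by `owner` as a whole loses nowhere and gains wherever they
  -- differ on a contested color.
  owners-win : ∀ {α π} → Optimal (contest α α) π → ∀ {j k} → slot j ≡ just k → π j ≡ owner j
  owners-win {α} {π} optimal {j} {k} some with π j ≟ owner j
  ... | yes eq = eq
  ... | no  πj≢ = contradiction
    (subst (items α α (π j) j <_) (sym (items-owner α α some)) lt)
    (contest-not-improvable α α π owner optimal balanced le j)
    where
    le : ∀ j → items α α (π j) j ≤ items α α (owner j) j
    le j with slot j
    ... | nothing = z≤n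
    ... | just k rewrite dec-true (owner j ≟ owner j) refl
          with does (π j ≟ owner j) | does (π j ≟ rival)
    ...   | true  | _     = ≤-refl
    ...   | false | true  = +-monoʳ-≤ (2 * α k) (s≤s z≤n)
    ...   | false | false = z≤n
    lt : items α α (π j) j < 2 * α k + 2
    lt rewrite some | dec-false (π j ≟ owner j) πj≢ with does (π j ≟ rival)
    ... | true  = +-monoʳ-< (2 * α k) (s≤s (s≤s z≤n))
    ... | false = subst (0 <_) (+-comm 2 (2 * α k)) (s≤s z≤n)

  -- Where the rival outbids the owner, exchanging that color with the rival's
  -- spare one pays.
  owners-lose : ∀ {α β π k} → α k < β k → Optimal (contest α β) π →
                ¬ (∀ {j k} → slot j ≡ just k → π j ≡ owner j)
  owners-lose {α} {β} {π} {k} αk<βk optimal wins =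
    contest-not-improvable α β π ρ optimal (balanced-∘ owner τ balanced) le j₀ lt
    where
    j₀ = color k
    τ = transpose j₀ spare
    ρ : Assignment n m
    ρ = owner ∘ (τ ⟨$⟩ʳ_)
    ρj₀ : ρ j₀ ≡ rival
    ρj₀ rewrite dec-true (j₀ ≟ j₀) refl = owner-spare
    -- `spare` is uncontested because the rival owns it, so the exchange moves no contested color
    -- other than `j₀`.
    ρ-owner : ∀ {j l} → j ≢ j₀ → slot j ≡ just l → ρ j ≡ owner j
    ρ-owner {j} j≢j₀ some rewrite dec-false (j ≟ j₀) j≢j₀
      | dec-false (j ≟ spare) (λ where refl → owner≢rival some owner-spare) = refl
    lt : items α β (π j₀) j₀ < items α β (ρ j₀) j₀
    lt rewrite wins (slot-color k) | ρj₀ | items-owner α β (slot-color k)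
             | items-rival α β (slot-color k) = begin-strict
      2 * α k + 2   ≡⟨ +-comm (2 * α k) 2 ⟩
      2 + 2 * α k   ≡⟨ *-suc 2 (α k) ⟨
      2 * suc (α k) ≤⟨ *-monoʳ-≤ 2 αk<βk ⟩
      2 * β k       <⟨ n<1+n _ ⟩
      1 + 2 * β k   ≡⟨ +-comm 1 (2 * β k) ⟩
      2 * β k + 1   ∎
      where open ≤-Reasoning
    le : ∀ j → items α β (π j) j ≤ items α β (ρ j) j
    le j = cases (j ≟ j₀) (slot j) refl
      where
      cases : Dec (j ≡ j₀) → ∀ s → slot j ≡ s → items α β (π j) j ≤ items α β (ρ j) j
      cases (yes j≡j₀) _ _ = subst (λ i → items α β (π i) i ≤ items α β (ρ i) i) (sym j≡j₀) (<⇒≤ lt)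
      cases (no _) nothing none = ≤-trans (≤-reflexive (items-uncontested α β (π j) none)) z≤n
      cases (no j≢j₀) (just l) some = ≤-reflexive (cong (λ i → items α β i j)
        (trans (wins some) (sym (ρ-owner j≢j₀ some))))

  -- Stated for bare decisions, so that both models can use it: `D` comes from the run matched for
  -- `α`, `E` from the mixed one. The claims of the owners carry over from `D` to `E`, where they
  -- are not optimal.
  mixed-run-fails : ∀ {α β k} {D E : Fin n → Maybe (Subset m)} {S : Fin n → Set} → α k < β k →
    (∀ {j k} → slot j ≡ just k → S (owner j)) →
    Correct (contest α α) D → Correct (contest α β) E → ¬ (∀ i → S i → E i ≡ D i)
  mixed-run-fails {α} {β} {D = D} {E} αk<βk inside (π , π-opt , D≡) (ρ , ρ-opt , E≡) agree =
    owners-lose {α} {β} αk<βk ρ-opt λ {j} some →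
      colorsOf-injective ρ π (owner j)
        (just-injective (trans (sym (E≡ (owner j))) (trans (agree (owner j) (inside some)) (D≡ (owner j)))))
        j (owners-win {α} π-opt some)

-- Prefix codes and the number of transcripts

∑-min : ∀ k (f : Fin (suc k) → ℕ) → ∃[ i ] suc k * f i ≤ ∑ f
∑-min zero    f = zero , ≤-refl
∑-min (suc k) f with ∑-min k (f ∘ suc)
... | i , le with ≤-total (f zero) (f (suc i))
...   | inj₁ f₀≤ = zero , +-monoʳ-≤ (f zero) (≤-trans (*-monoʳ-≤ (suc k) f₀≤) le)
...   | inj₂ ≤f₀ = suc i , +-mono-≤ ≤f₀ le

-- One list is a prefix of the other, in the form to which `cancel` applies.
_≍_ : (xs ys : List Bool) → Set
xs ≍ ys = ∃₂ λ us ws → xs ++ us ≡ ys ++ ws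

-- Short lists are padded with `false`. This identifies some lists with their extensions, which is
-- harmless for prefix codes.
pack : ∀ L → List Bool → Fin (2 ^ L)
pack zero    _        = zero
pack (suc L) []       = combine {2} zero (pack L [])
pack (suc L) (b ∷ bs) = combine {2} (if b then suc zero else zero) (pack L bs)

pack-injective : ∀ L xs ys → length xs ≤ L → length ys ≤ L → pack L xs ≡ pack L ys → xs ≍ ys
pack-injective L       []       ys       _       _       _  = ys , [] , sym (++-identityʳ ys)
pack-injective L       (x ∷ xs) []       _       _       _  = [] , (x ∷ xs) , ++-identityʳ (x ∷ xs)
pack-injective (suc L) (x ∷ xs) (y ∷ ys) (s≤s p) (s≤s q) eq
  with combine-injective {2} (if x then suc zero else zero) (pack L xs) (if y then suc zero else zero) (pack L ys) eq
... | b≡ , eq′ with x | y | pack-injective L xs ys p q eq′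
...   | true  | true  | us , ws , e = us , ws , cong (true ∷_) e
...   | false | false | us , ws , e = us , ws , cong (false ∷_) e
...   | true  | false | _ = contradiction b≡ λ ()
...   | false | true  | _ = contradiction b≡ λ ()

collision : ∀ {N L} (f : Fin N → List Bool) → (∀ z → length (f z) ≤ L) → 2 ^ L < N →
            ∃₂ λ z z′ → z ≢ z′ × f z ≍ f z′
collision {N} {L} f short lt with pigeonhole lt (pack L ∘ f)
... | z , z′ , z<z′ , eq = z , z′ , (λ { refl → <-irrefl refl z<z′ }) ,
  pack-injective L (f z) (f z′) (short z) (short z′) eq

-- The remainders `us` and `ws` let codes be composed by concatenation. `P` restricts to values that
-- a code of fixed width does not truncate.
record PrefixFree {A : Set} (P : A → Set) (enc : A → List Bool) : Set where
  constructor prefix-free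
  field
    cancel : ∀ {x y} us ws → P x → P y → enc x ++ us ≡ enc y ++ ws → x ≡ y × us ≡ ws

open PrefixFree

module _ {A : Set} {P : A → Set} {enc : A → List Bool} (pf : PrefixFree P enc) where

  listCode : List A → List Bool
  listCode []       = false ∷ []
  listCode (x ∷ xs) = true ∷ enc x ++ listCode xs

  listCode-pf : PrefixFree (All P) listCode
  cancel listCode-pf {[]}     {[]}     us ws _ _ eq = refl , proj₂ (∷-injective eq)
  cancel listCode-pf {x ∷ xs} {y ∷ ys} us ws (px ∷ pxs) (py ∷ pys) eq
    with cancel pf (listCode xs ++ us) (listCode ys ++ ws) px py
           (trans (sym (++-assoc (enc x) _ us)) (trans (proj₂ (∷-injective eq)) (++-assoc (enc y) _ ws)))
  ... | refl , eq′ with cancel listCode-pf us ws pxs pys eq′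
  ...   | refl , eq″ = refl , eq″

  -- The `suc` in the hypothesis pays for the bit that announces an element, the one in the
  -- conclusion for the bit that ends the list.
  listCode-length : ∀ (weight : A → ℕ) W → (∀ x → suc (length (enc x)) ≤ weight x * W) →
                    ∀ xs → length (listCode xs) ≤ suc (sumˡ (List.map weight xs) * W)
  listCode-length weight W short []       = ≤-refl
  listCode-length weight W short (x ∷ xs) = begin
    suc (length (enc x ++ listCode xs))              ≡⟨ cong suc (length-++ (enc x)) ⟩
    suc (length (enc x) + length (listCode xs))      ≤⟨ +-mono-≤ (short x) (listCode-length weight W short xs) ⟩
    weight x * W + suc (sumˡ (List.map weight xs) * W) ≡⟨ +-suc (weight x * W) _ ⟩
    suc (weight x * W + sumˡ (List.map weight xs) * W) ≡⟨ cong suc (*-distribʳ-+ W (weight x) _) ⟨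
    suc ((weight x + sumˡ (List.map weight xs)) * W) ∎
    where open ≤-Reasoning

pairCode-pf : ∀ {A B : Set} {P : A → Set} {R : B → Set} {enc : A → List Bool} {enc′ : B → List Bool} →
  PrefixFree P enc → PrefixFree R enc′ →
  PrefixFree {A × B} (λ (x , y) → P x × R y) (λ (x , y) → enc x ++ enc′ y)
cancel (pairCode-pf {enc = enc} {enc′} pf pf′) {x , x′} {y , y′} us ws (px , px′) (py , py′) eq
  with cancel pf (enc′ x′ ++ us) (enc′ y′ ++ ws) px py
         (trans (sym (++-assoc (enc x) _ us)) (trans eq (++-assoc (enc y) _ ws)))
... | refl , eq′ with cancel pf′ us ws px′ py′ eq′
...   | refl , eq″ = refl , eq″

-- The `k` lowest binary digits, least significant first, with `true` for the digit 0.
bits : ℕ → ℕ → List Bool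
bits zero    t = []
bits (suc k) t = (t % 2 ≡ᵇ 0) ∷ bits k (t / 2)

bits-length : ∀ k t → length (bits k t) ≡ k
bits-length zero    t = refl
bits-length (suc k) t = cong suc (bits-length k (t / 2))

parity-injective : ∀ {a b} → a < 2 → b < 2 → (a ≡ᵇ 0) ≡ (b ≡ᵇ 0) → a ≡ b
parity-injective {0} {0} _ _ _ = refl
parity-injective {1} {1} _ _ _ = refl
parity-injective {0} {1} _ _ ()
parity-injective {1} {0} _ _ ()
parity-injective {suc (suc _)} (s≤s (s≤s ())) _ _
parity-injective {0} {suc (suc _)} _ (s≤s (s≤s ())) _
parity-injective {1} {suc (suc _)} _ (s≤s (s≤s ())) _

bits-pf : ∀ k → PrefixFree (_< 2 ^ k) (bits k)
cancel (bits-pf zero) {zero}  {zero}  us ws _ _ eq = refl , eq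
cancel (bits-pf zero) {suc _} {_}     us ws (s≤s ()) _ eq
cancel (bits-pf zero) {zero}  {suc _} us ws _ (s≤s ()) eq
cancel (bits-pf (suc k)) {x} {y} us ws px py eq
  with cancel (bits-pf k) us ws (half px) (half py) (proj₂ (∷-injective eq))
  where
  half : ∀ {t} → t < 2 ^ suc k → t / 2 < 2 ^ k
  half {t} lt = m<n*o⇒m/o<n (subst (t <_) (*-comm 2 (2 ^ k)) lt)
... | x/2≡y/2 , us≡ws = x≡y , us≡ws
  where
  x≡y : x ≡ y
  x≡y = begin
    x                   ≡⟨ m≡m%n+[m/n]*n x 2 ⟩
    x % 2 + x / 2 * 2   ≡⟨ cong₂ (λ a b → a + b * 2)
                            (parity-injective (m%n<n x 2) (m%n<n y 2) (proj₁ (∷-injective eq))) x/2≡y/2 ⟩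
    y % 2 + y / 2 * 2   ≡⟨ m≡m%n+[m/n]*n y 2 ⟨
    y                   ∎
    where open ≡-Reasoning

finCode-pf : ∀ {n} k → n ≤ 2 ^ k → PrefixFree {Fin n} (λ _ → ⊤) (bits k ∘ toℕ)
cancel (finCode-pf k n≤2^k) {x} {y} us ws _ _ eq
  with cancel (bits-pf k) us ws (<-≤-trans (toℕ<n x) n≤2^k) (<-≤-trans (toℕ<n y) n≤2^k) eq
... | x≡y , us≡ws = toℕ-injective x≡y , us≡ws

boolCode-pf : PrefixFree {Bool} (λ _ → ⊤) (_∷ [])
cancel boolCode-pf us ws _ _ eq = ∷-injective eq

messageCode : Message → List Bool
messageCode = listCode boolCode-pf

messageCode-length : ∀ msg → length (messageCode msg) ≡ suc (2 * length msg)
messageCode-length []        = refl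
messageCode-length (_ ∷ msg) = cong suc (trans (cong suc (messageCode-length msg)) (sym (*-suc 2 (length msg))))

-- A time (0 in asynchronous runs), the link as seen from one of its ends, and
-- the message.
Item : ℕ → Set
Item n = ℕ × (Fin n × Side) × Message

link : ∀ {n} → Item n → Fin n × Side
link (_ , e , _) = e

-- Shared by both models. `level` names the only cut that a link can cross, so `crosses-level`
-- expresses that the boundaries are disjoint.
module Transcripts
  {n : ℕ} (weight : Message → ℕ) (capacity : ℕ)
  (weight-pos : ∀ msg → 1 ≤ weight msg) (weight-length : ∀ msg → length msg ≤ weight msg * capacity)
  (r′ : ℕ) (Crosses : Fin (suc r′) → Fin n × Side → Set) (crosses? : ∀ l → Decidable (Crosses l))
  (level : Fin n × Side → ℕ) (crosses-level : ∀ {l e} → Crosses l e → toℕ l ≡ level e)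
  where

  cost-of : List (Item n) → ℕ
  cost-of xs = sumˡ (List.map (λ (_ , _ , msg) → weight msg) xs)

  crossing : Fin (suc r′) → List (Item n) → List (Item n)
  crossing l = filter (crosses? l ∘ link)

  ∑-crossing : ∀ xs → ∑ (λ l → cost-of (crossing l xs)) ≤ cost-of xs
  ∑-crossing []                    = ≤-reflexive (∑-zero (suc r′))
  ∑-crossing (x@(_ , e , msg) ∷ xs) = begin
    ∑ (λ l → cost-of (crossing l (x ∷ xs)))
      ≡⟨ ∑-cong {g = λ l → (if does (crosses? l e) then weight msg else 0) + cost-of (crossing l xs)} first ⟩
    ∑ (λ l → (if does (crosses? l e) then weight msg else 0) + cost-of (crossing l xs))
      ≡⟨ ∑-+ (λ l → if does (crosses? l e) then weight msg else 0) (λ l → cost-of (crossing l xs)) ⟩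
    ∑ (λ l → if does (crosses? l e) then weight msg else 0) + ∑ (λ l → cost-of (crossing l xs))
      ≤⟨ +-mono-≤ (∑-at-most-one (λ l → does (crosses? l e)) (level e) (weight msg) once) (∑-crossing xs) ⟩
    weight msg + cost-of xs ∎
    where
    open ≤-Reasoning
    first : ∀ l → cost-of (crossing l (x ∷ xs)) ≡
                  (if does (crosses? l e) then weight msg else 0) + cost-of (crossing l xs)
    first l with does (crosses? l e)
    ... | true  = refl
    ... | false = refl
    once : ∀ l → does (crosses? l e) ≡ true → toℕ l ≡ level e
    once l eq with crosses? l e
    ... | yes cr = crosses-level cr

  cheapest : List (Item n) → Fin (suc r′)
  cheapest xs = proj₁ (∑-min r′ (λ l → cost-of (crossing l xs)))

  cheapest-≤ : ∀ xs → suc r′ * cost-of (crossing (cheapest xs) xs) ≤ cost-of xs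
  cheapest-≤ xs = ≤-trans (proj₂ (∑-min r′ (λ l → cost-of (crossing l xs)))) (∑-crossing xs)

  module _ (ν k : ℕ) (n≤2^ν : n ≤ 2 ^ ν) (r≤2^ν : suc r′ ≤ 2 ^ ν) where

    Timely : Item n → Set
    Timely (t , _) = t < 2 ^ k

    private

      Timely′ : Item n → Set
      Timely′ (t , _ , msg) = t < 2 ^ k × (⊤ × ⊤) × All (λ _ → ⊤) msg

      timely′ : ∀ {x} → Timely x → Timely′ x
      timely′ {_ , _ , msg} lt = lt , _ , All.universal _ msg

      itemCode : Item n → List Bool
      itemCode (t , (i , d) , msg) = bits k t ++ ((bits ν (toℕ i) ++ bits 1 (toℕ d)) ++ messageCode msg)

      itemCode-pf : PrefixFree Timely′ itemCode
      itemCode-pf = pairCode-pf (bits-pf k) (pairCode-pf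
        (pairCode-pf (finCode-pf ν n≤2^ν) (finCode-pf 1 ≤-refl)) (listCode-pf boolCode-pf))

      W : ℕ
      W = 3 + k + ν + 2 * capacity

      itemCode-length : ∀ x → suc (length (itemCode x)) ≤ weight (proj₂ (proj₂ x)) * W
      itemCode-length (t , (i , d) , msg) = begin
        suc (length (bits k t ++ ((bits ν (toℕ i) ++ bits 1 (toℕ d)) ++ messageCode msg)))
          ≡⟨ cong suc (length-++ (bits k t)) ⟩
        suc (length (bits k t) + length ((bits ν (toℕ i) ++ bits 1 (toℕ d)) ++ messageCode msg))
          ≡⟨ cong₂ (λ a b → suc (a + b)) (bits-length k t) (length-++ (bits ν (toℕ i) ++ bits 1 (toℕ d))) ⟩
        suc (k + (length (bits ν (toℕ i) ++ bits 1 (toℕ d)) + length (messageCode msg)))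
          ≡⟨ cong₂ (λ a b → suc (k + (a + b))) 
               (trans (length-++ (bits ν (toℕ i))) (cong₂ _+_ (bits-length ν (toℕ i)) (bits-length 1 (toℕ d))))
               (messageCode-length msg) ⟩
        suc (k + (ν + 1 + suc (2 * length msg)))
          ≡⟨ regroup k ν (length msg) ⟩
        1 * (3 + k + ν) + 2 * length msg
          -- The weight is used twice: being at least 1 it pays for the header, and times `capacity`
          -- it pays for the content.
          ≤⟨ +-mono-≤ (*-monoˡ-≤ (3 + k + ν) (weight-pos msg)) (*-monoʳ-≤ 2 (weight-length msg)) ⟩
        weight msg * (3 + k + ν) + 2 * (weight msg * capacity)
          ≡⟨ distrib (weight msg) (3 + k + ν) capacity ⟩
        weight msg * W ∎
        where
        open ≤-Reasoning
        regroup : ∀ k ν x → suc (k + (ν + 1 + suc (2 * x))) ≡ 1 * (3 + k + ν) + 2 * x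
        regroup = solve-∀
        distrib : ∀ w a b → w * a + 2 * (w * b) ≡ w * (a + 2 * b)
        distrib = solve-∀

      -- Two transcripts are comparable only across the same cut, and the cheapest one depends on
      -- the run, so the key has to name it.
      keyCode : Fin (suc r′) × ℕ × List (Item n) → List Bool
      keyCode (l , s , xs) = bits ν (toℕ l) ++ (bits k s ++ listCode itemCode-pf xs)

      keyCode-pf : PrefixFree (λ (l , s , xs) → ⊤ × s < 2 ^ k × All Timely′ xs) keyCode
      keyCode-pf = pairCode-pf (finCode-pf ν r≤2^ν) (pairCode-pf (bits-pf k) (listCode-pf itemCode-pf))

      keyCode-length : ∀ l s xs → length (keyCode (l , s , xs)) ≤ ν + (k + suc (cost-of xs * W))
      keyCode-length l s xs = begin
        length (keyCode (l , s , xs))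
          ≡⟨ trans (length-++ (bits ν (toℕ l))) (cong₂ _+_ (bits-length ν (toℕ l)) (length-++ (bits k s))) ⟩
        ν + (length (bits k s) + length (listCode itemCode-pf xs))
          ≤⟨ +-monoʳ-≤ ν (+-mono-≤ (≤-reflexive (bits-length k s)) (listCode-length itemCode-pf _ W itemCode-length xs)) ⟩
        ν + (k + suc (cost-of xs * W)) ∎
        where open ≤-Reasoning

    -- The bound on q is the length of the code of a cut, a stopping time and a
    -- transcript worth b basic messages: an item of this takes k bits for its time,
    -- ν + 1 for the link, 2 |msg| + 1 for the message and one to announce it.
    transcripts-collide : ∀ {q} (events : Fin (2 ^ q) → List (Item n)) (stamp : Fin (2 ^ q) → ℕ) →
      (∀ z → All Timely (events z)) → (∀ z → stamp z < 2 ^ k) →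
      (∀ z b → suc r′ * b ≤ cost-of (events z) → suc (ν + (k + suc (b * (3 + k + ν + 2 * capacity)))) ≤ q) →
      ∃₂ λ z z′ → z ≢ z′ × stamp z ≡ stamp z′ × (∃[ l ] crossing l (events z) ≡ crossing l (events z′))
    -- The bound `few` starts with `suc`, so `q` is positive and the keys have at most `pred q`
    -- bits: half as many packed keys as inputs.
    transcripts-collide {zero} events _ _ _ few with few zero 0 (≤-trans (≤-reflexive (*-zeroʳ r′)) z≤n)
    ... | ()
    transcripts-collide {suc q} events stamp timely stamped few
      with collision code short (^-monoʳ-< 2 (s≤s (s≤s z≤n)) (n<1+n q))
      where
      code : Fin (2 ^ suc q) → List Bool
      code z = keyCode (cheapest (events z) , stamp z , crossing (cheapest (events z)) (events z))
      short : ∀ z → length (code z) ≤ q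
      short z = ≤-trans (keyCode-length (cheapest (events z)) (stamp z) (crossing (cheapest (events z)) (events z)))
        (s≤s⁻¹ (few z _ (cheapest-≤ (events z))))
    ... | z , z′ , z≢z′ , us , ws , eq
        with cancel keyCode-pf us ws (valid z) (valid z′) eq
      where
      valid : ∀ z → ⊤ × stamp z < 2 ^ k × All Timely′ (crossing (cheapest (events z)) (events z))
      valid z = tt , stamped z , filter⁺ (crosses? (cheapest (events z)) ∘ link) (All.map (λ {x} → timely′ {x}) (timely z))
    ...   | key≡ , _ = z , z′ , z≢z′ , cong (proj₁ ∘ proj₂) key≡ , cheapest (events z) ,
        trans (cong (proj₂ ∘ proj₂) key≡) (cong (λ l → crossing l (events z′)) (sym (cong proj₁ key≡)))

-- The geometry of the ring

module _ {k : ℕ} where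

  -- The successor on the ring without `mod`. Both directions of `neighbour` are characterized by
  -- it, which gives their inverse laws and the change of depth by case analysis.
  Next : (x y : Fin (suc k)) → Set
  Next x y = toℕ y ≡ suc (toℕ x) ⊎ toℕ x ≡ k × toℕ y ≡ 0

  Next-functional : ∀ {x y z} → Next x y → Next x z → y ≡ z
  Next-functional (inj₁ p)       (inj₁ q)       = toℕ-injective (trans p (sym q))
  Next-functional (inj₂ (_ , p)) (inj₂ (_ , q)) = toℕ-injective (trans p (sym q))
  Next-functional {y = y} (inj₁ p) (inj₂ (q , _)) =
    contradiction (subst (_< suc k) (trans p (cong suc q)) (toℕ<n y)) (<-irrefl refl)
  Next-functional {z = z} (inj₂ (q , _)) (inj₁ p) =
    contradiction (subst (_< suc k) (trans p (cong suc q)) (toℕ<n z)) (<-irrefl refl)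

  Next-injective : ∀ {x y z} → Next x z → Next y z → x ≡ y
  Next-injective (inj₁ p)       (inj₁ q)       = toℕ-injective (suc-injective (trans (sym p) q))
  Next-injective (inj₂ (p , _)) (inj₂ (q , _)) = toℕ-injective (trans p (sym q))
  Next-injective (inj₁ p)       (inj₂ (_ , q)) = contradiction (trans (sym p) q) λ ()
  Next-injective (inj₂ (_ , q)) (inj₁ p)       = contradiction (trans (sym p) q) λ ()

  Next-right : ∀ x → Next x (neighbour right x)
  Next-right x with m≤n⇒m<n∨m≡n (toℕ<n x)
  ... | inj₁ x+1<n = inj₁ (trans (toℕ-fromℕ< _) (m<n⇒m%n≡m x+1<n))
  ... | inj₂ x+1≡n = inj₂ (suc-injective x+1≡n ,
    trans (toℕ-fromℕ< _) (trans (cong (_% suc k) x+1≡n) (n%n≡0 (suc k))))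

  Next-left : ∀ x → Next (neighbour left x) x
  Next-left x with toℕ x in eq
  ... | zero  = inj₂ (trans (toℕ-fromℕ< _) (m<n⇒m%n≡m (n<1+n k)) , refl)
  ... | suc y = inj₁ (cong suc (sym (begin
    toℕ ((suc y + k) mod suc k) ≡⟨ toℕ-fromℕ< _ ⟩
    (suc y + k) % suc k         ≡⟨ cong (_% suc k) (+-suc y k) ⟨
    (y + suc k) % suc k         ≡⟨ [m+n]%n≡m%n y (suc k) ⟩
    y % suc k                   ≡⟨ m<n⇒m%n≡m (<-trans (n<1+n y) (subst (_< suc k) eq (toℕ<n x))) ⟩
    y                           ∎)))
    where open ≡-Reasoning

neighbour-opposite : ∀ {n} .{{_ : NonZero n}} d (i : Fin n) → neighbour (opposite d) (neighbour d i) ≡ i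
neighbour-opposite {suc _} left  i = Next-functional (Next-right (neighbour left i)) (Next-left i)
neighbour-opposite {suc _} right i = Next-injective (Next-left (neighbour right i)) (Next-right i)

opposite-involutive : ∀ (d : Side) → opposite (opposite d) ≡ d
opposite-involutive left  = refl
opposite-involutive right = refl

∑-neighbour : ∀ {n} .{{_ : NonZero n}} d (f : Fin n → ℕ) → ∑ (λ i → f (neighbour d i)) ≡ ∑ f
∑-neighbour d f = sym (sum-permute +-0-commutativeMonoid f
  (permutation (neighbour d) (neighbour (opposite d)) back forth))
  where
  back : ∀ i → neighbour d (neighbour (opposite d) i) ≡ i
  back i = subst (λ e → neighbour e (neighbour (opposite d) i) ≡ i)
    (opposite-involutive d) (neighbour-opposite (opposite d) i)
  forth : ∀ i → neighbour (opposite d) (neighbour d i) ≡ i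
  forth = neighbour-opposite d

-- The distance to agent 0.
depth : ∀ {n} → Fin n → ℕ
depth {n} i = toℕ i ⊓ (n ∸ toℕ i)

Next-depth : ∀ {k} {x y : Fin (suc k)} → Next x y → depth x ≤ suc (depth y) × depth y ≤ suc (depth x)
Next-depth {k} {x} {y} (inj₁ y≡1+x) rewrite y≡1+x =
  ⊓-mono-≤ (≤-trans (n≤1+n (toℕ x)) (n≤1+n _))
           (≤-reflexive (+-∸-assoc 1 (s≤s⁻¹ (toℕ<n x)))) ,
  ⊓-mono-≤ ≤-refl (≤-trans (∸-monoʳ-≤ (suc k) (n≤1+n (toℕ x))) (n≤1+n _))
Next-depth {k} (inj₂ (x≡k , y≡0)) rewrite x≡k | y≡0 =
  ≤-trans (m⊓n≤n k (suc k ∸ k)) (≤-reflexive (m+n∸n≡m 1 k)) , z≤n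

inside : ∀ {n} → ℕ → Fin n → Bool
inside l i = does (l <? depth i)

Crosses : ∀ {n} .{{_ : NonZero n}} → ℕ → Fin n × Side → Set
Crosses l (i , d) = inside l i ≢ inside l (neighbour d i)

inside-level : ∀ {l a b} → a ≤ suc b → b ≤ suc a → does (l <? a) ≢ does (l <? b) → l ≡ a ⊓ b
inside-level {l} {a} {b} a≤ b≤ = cases (l <? a) (l <? b)
  where
  cases : (p : Dec (l < a)) (q : Dec (l < b)) → does p ≢ does q → l ≡ a ⊓ b
  cases (yes _)   (yes _)   differ = contradiction refl differ
  cases (no _)    (no _)    differ = contradiction refl differ
  cases (yes l<a) (no l≮b) _ = trans l≡b (sym (m≥n⇒m⊓n≡n (≤-trans (≮⇒≥ l≮b) (<⇒≤ l<a))))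
    where
    l≡b : l ≡ b
    l≡b = ≤-antisym (s≤s⁻¹ (≤-trans l<a a≤)) (≮⇒≥ l≮b)
  cases (no l≮a)  (yes l<b) _ = trans l≡a (sym (m≤n⇒m⊓n≡m (≤-trans (≮⇒≥ l≮a) (<⇒≤ l<b))))
    where
    l≡a : l ≡ a
    l≡a = ≤-antisym (s≤s⁻¹ (≤-trans l<b b≤)) (≮⇒≥ l≮a)

-- The depths at the ends of a link differ by at most one, so a single threshold can separate them:
-- boundaries of different levels share no link.
crosses-level : ∀ {n} .{{_ : NonZero n}} {l} {e@(i , d) : Fin n × Side} →
                Crosses l e → l ≡ depth i ⊓ depth (neighbour d i)
crosses-level {suc _} {e = i , left}  differ with Next-depth (Next-left i)
... | le , ge = inside-level ge le differ
crosses-level {suc _} {e = i , right} differ with Next-depth (Next-right i)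
... | le , ge = inside-level le ge differ

-- Synchronous runs

decided : ∀ {A : Set} {x : Maybe A} → Is-just x → ∃[ a ] x ≡ just a
decided {x = just a} _ = a , refl

just-decided : ∀ {A : Set} {x : Maybe A} {a} → x ≡ just a → Is-just x
just-decided refl = Maybeᴬ.just tt

allDecided? : ∀ {n m} (D : Fin n → Maybe (Subset m)) → Dec (AllDecided D)
allDecided? D = all? λ i → Maybeᴬ.dec (λ _ → yes tt) (D i)

crosses? : ∀ {n} .{{_ : NonZero n}} l → Decidable (Crosses {n} l)
crosses? l (i , d) = ¬? (inside l i Bool.≟ inside l (neighbour d i))

sum-concat-tabulate : ∀ {A : Set} (w : A → ℕ) {k} (f : Fin k → List A) →
  sumˡ (List.map w (concat (List.tabulate f))) ≡ ∑ λ i → sumˡ (List.map w (f i))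
sum-concat-tabulate w {zero}  f = refl
sum-concat-tabulate w {suc k} f = begin
  sumˡ (List.map w (f zero ++ concat (List.tabulate (f ∘ suc))))
    ≡⟨ cong sumˡ (map-++ w (f zero) _) ⟩
  sumˡ (List.map w (f zero) ++ List.map w (concat (List.tabulate (f ∘ suc))))
    ≡⟨ sum-++ (List.map w (f zero)) _ ⟩
  sumˡ (List.map w (f zero)) + sumˡ (List.map w (concat (List.tabulate (f ∘ suc))))
    ≡⟨ cong (sumˡ (List.map w (f zero)) +_) (sum-concat-tabulate w (f ∘ suc)) ⟩
  sumˡ (List.map w (f zero)) + (∑ λ i → sumˡ (List.map w (f (suc i)))) ∎
  where open ≡-Reasoning

module SyncRuns {n m : ℕ} .{{nt : NonTrivial n}} (A : SyncAlgorithm n m) where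
  open SyncAlgorithm A
  open Sync A

  private instance
    n≢0 : NonZero n
    n≢0 = nonTrivial⇒nonZero n

  item : ℕ → Fin n → Side → Maybe Message → List (Item n)
  item s i d = maybe′ (λ msg → (s , (i , d) , msg) ∷ []) []

  module _ (s : ℕ) (out : Fin n → Side → Maybe Message) where

    agentItems : Fin n → List (Item n)
    agentItems i = concat (List.tabulate λ d → item s i d (out i d))

    roundItems : List (Item n)
    roundItems = concat (List.tabulate agentItems)

  -- A message of round `suc s` has stamp `s`, so `t` rounds use the stamps below `t`. The link is
  -- seen from the sender.
  events : Instance n m → ℕ → List (Item n)
  events Q zero    = []
  events Q (suc t) = events Q t ++ roundItems t (sent (run Q (suc t)))

  ∈-roundItems : ∀ {s i d msg} out → out i d ≡ just msg → (s , (i , d) , msg) ∈ roundItems s out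
  ∈-roundItems {s} {i} {d} {msg} out eq = ∈-concat⁺′
    (∈-concat⁺′ (subst (λ o → (s , (i , d) , msg) ∈ item s i d o) (sym eq) (here refl))
      (∈-tabulate⁺ {f = λ d → item s i d (out i d)} d))
    (∈-tabulate⁺ {f = agentItems s out} i)

  roundItems-∈ : ∀ {s s′ i d msg} out → (s , (i , d) , msg) ∈ roundItems s′ out → s ≡ s′ × out i d ≡ just msg
  roundItems-∈ {s} {s′} {i} {d} {msg} out x∈
    with ∈-concat⁻′ (List.tabulate (agentItems s′ out)) x∈
  ... | ys , x∈ys , ys∈ with ∈-tabulate⁻ {f = agentItems s′ out} ys∈
  ...   | i′ , refl with ∈-concat⁻′ (List.tabulate λ d → item s′ i′ d (out i′ d)) x∈ys
  ...     | zs , x∈zs , zs∈ with ∈-tabulate⁻ {f = λ d → item s′ i′ d (out i′ d)} zs∈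
  ...       | d′ , refl with out i′ d′ in eq
  ...         | just msg′ with x∈zs
  ...           | here refl = refl , eq

  ∈-events : ∀ Q {s t i d msg} → s < t → sent (run Q (suc s)) i d ≡ just msg → (s , (i , d) , msg) ∈ events Q t
  ∈-events Q {s} {suc t} s<1+t eq with m≤n⇒m<n∨m≡n (s≤s⁻¹ s<1+t)
  ... | inj₁ s<t  = ∈-++⁺ˡ (∈-events Q s<t eq)
  ... | inj₂ refl = ∈-++⁺ʳ (events Q t) (∈-roundItems (sent (run Q (suc t))) eq)

  events-∈ : ∀ Q t {s i d msg} → (s , (i , d) , msg) ∈ events Q t → s < t × sent (run Q (suc s)) i d ≡ just msg
  events-∈ Q (suc t) x∈ with ∈-++⁻ (events Q t) x∈
  ... | inj₁ old with events-∈ Q t old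
  ...   | s<t , eq = m<n⇒m<1+n s<t , eq
  events-∈ Q (suc t) x∈ | inj₂ new with roundItems-∈ (sent (run Q (suc t))) new
  ...   | refl , eq = n<1+n t , eq

  events-timely : ∀ Q t → All (λ (s , _) → s < t) (events Q t)
  events-timely Q t = All.tabulate λ x∈ → proj₁ (events-∈ Q t x∈)

  events-cost : ∀ c .{{_ : NonZero c}} Q t →
    sumˡ (List.map (λ (_ , _ , msg) → basicMessages c n msg) (events Q t)) ≡ messagesSent c Q t
  events-cost c Q zero    = refl
  events-cost c Q (suc t) = begin
    sumˡ (List.map weight (events Q t ++ roundItems t out))
      ≡⟨ cong sumˡ (map-++ weight (events Q t) _) ⟩
    sumˡ (List.map weight (events Q t) ++ List.map weight (roundItems t out))
      ≡⟨ sum-++ (List.map weight (events Q t)) _ ⟩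
    sumˡ (List.map weight (events Q t)) + sumˡ (List.map weight (roundItems t out))
      ≡⟨ cong₂ _+_ (events-cost c Q t) (trans (sum-concat-tabulate weight (agentItems t out)) (∑-cong agent)) ⟩
    messagesSent c Q t + (∑ λ i → ∑ λ d → maybe′ (basicMessages c n) 0 (out i d)) ∎
    where
    open ≡-Reasoning
    weight : Item n → ℕ
    weight (_ , _ , msg) = basicMessages c n msg
    out = sent (run Q (suc t))
    single : ∀ i d o → sumˡ (List.map weight (item t i d o)) ≡ maybe′ (basicMessages c n) 0 o
    single i d nothing    = refl
    single i d (just msg) = +-identityʳ _
    agent : ∀ i → sumˡ (List.map weight (agentItems t out i)) ≡
                  ∑ λ d → maybe′ (basicMessages c n) 0 (out i d)
    agent i = trans (sum-concat-tabulate weight (λ d → item t i d (out i d))) (∑-cong λ d → single i d (out i d))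

  messagesSent-mono : ∀ c .{{_ : NonZero c}} Q {s t} → s ≤ t → messagesSent c Q s ≤ messagesSent c Q t
  messagesSent-mono c Q {s} {t} s≤t = go (≤⇒≤′ s≤t)
    where
    go : ∀ {t} → s ≤′ t → messagesSent c Q s ≤ messagesSent c Q t
    go (≤′-reflexive refl) = ≤-refl
    go (≤′-step le)        = ≤-trans (go le) (m≤m+n _ _)

  decision-stable : ∀ Q i {s t S} → s ≤ t → decisions (run Q s) i ≡ just S → decisions (run Q t) i ≡ just S
  decision-stable Q i {s} {S = S} s≤t eq = go (≤⇒≤′ s≤t)
    where
    go : ∀ {t} → s ≤′ t → decisions (run Q t) i ≡ just S
    go (≤′-reflexive refl) = eq
    go (≤′-step {n = t} le) = final i (state (run Q t) i) (received (run Q t) i left) (received (run Q t) i right) (go le)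

  module _ (side : Fin n → Bool) (Q : Instance n m) (Q̂ : Bool → Instance n m)
    (mixed : ∀ i → Q i ≡ Q̂ (side i) i) (t : ℕ)
    (agree : ∀ {s i d} → s < t → side i ≢ side (neighbour d i) →
             sent (run (Q̂ true) (suc s)) i d ≡ sent (run (Q̂ false) (suc s)) i d)
    where

    crossing-agree : ∀ {s i d} b b′ → s ≤ t → side i ≢ side (neighbour d i) →
                     sent (run (Q̂ b) s) i d ≡ sent (run (Q̂ b′) s) i d
    crossing-agree {zero}  _     _     _   _  = refl
    crossing-agree {suc s} true  true  _   _  = refl
    crossing-agree {suc s} false false _   _  = refl
    crossing-agree {suc s} true  false s<t cr = agree s<t cr
    crossing-agree {suc s} false true  s<t cr = sym (agree s<t cr)

    -- By induction every sender behaves as in the matched run of its own side. If the receiver is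
    -- on the other side, the link crosses the cut, where both matched runs send the same.
    mixed-run : ∀ s → s ≤ t → ∀ i →
      state (run Q s) i ≡ state (run (Q̂ (side i)) s) i ×
      (∀ d → sent (run Q s) i d ≡ sent (run (Q̂ (side i)) s) i d)
    mixed-run zero    _   i = cong (start i) (mixed i) , λ _ → refl
    mixed-run (suc s) s<t i = cong proj₁ next , λ d → cong (λ f → f d) (cong proj₂ next)
      where
      arrives : ∀ d → received (run Q s) i d ≡ received (run (Q̂ (side i)) s) i d
      arrives d = trans (proj₂ (mixed-run s (<⇒≤ s<t) j) (opposite d)) across
        where
        j = neighbour d i
        across : sent (run (Q̂ (side j)) s) j (opposite d) ≡ sent (run (Q̂ (side i)) s) j (opposite d)
        across with side j Bool.≟ side i
        ... | yes eq = cong (λ b → sent (run (Q̂ b) s) j (opposite d)) eq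
        ... | no  ne = crossing-agree (side j) (side i) (<⇒≤ s<t)
          λ eq → ne (trans eq (cong side (neighbour-opposite d i)))
      next : step i (state (run Q s) i) (received (run Q s) i left) (received (run Q s) i right) ≡
             step i (state (run (Q̂ (side i)) s) i) (received (run (Q̂ (side i)) s) i left)
                                                   (received (run (Q̂ (side i)) s) i right)
      next = trans (cong (λ st → step i st _ _) (proj₁ (mixed-run s (<⇒≤ s<t) i)))
                   (cong₂ (step i _) (arrives left) (arrives right))

  module _ (l : ℕ) (t : ℕ) where

    trace : Instance n m → List (Item n)
    trace Q = filter (crosses? l ∘ link) (events Q t)

    -- An item carries its round and its link, so membership in the trace is all that counts. Used
    -- in both directions, it also shows that the two runs are silent at the same moments.
    trace-sent : ∀ Q Q′ → trace Q ≡ trace Q′ → ∀ {s i d msg} → s < t → Crosses {n} l (i , d) →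
      sent (run Q (suc s)) i d ≡ just msg → sent (run Q′ (suc s)) i d ≡ just msg
    trace-sent Q Q′ same s<t cr eq = proj₂ (events-∈ Q′ t (proj₁ (∈-filter⁻ (crosses? l ∘ link)
      (subst (_ ∈_) same (∈-filter⁺ (crosses? l ∘ link) (∈-events Q s<t eq) cr)))))

    traces-agree : ∀ Q Q′ → trace Q ≡ trace Q′ → ∀ {s i d} → s < t → Crosses {n} l (i , d) →
      sent (run Q (suc s)) i d ≡ sent (run Q′ (suc s)) i d
    traces-agree Q Q′ same {s} {i} {d} s<t cr
      with sent (run Q (suc s)) i d in eq | sent (run Q′ (suc s)) i d in eq′
    ... | nothing  | nothing  = refl
    ... | just msg | o        = trans (sym (trace-sent Q Q′ same s<t cr eq)) eq′
    ... | nothing  | just msg = trans (sym eq) (trace-sent Q′ Q (sym same) s<t cr eq′)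

-- Indistinguishable synchronous runs

-- A contest in which every cut of level l ≤ r separates all owners of contested
-- colors from the rival.
record Arena (n m p r : ℕ) .{{n≢0 : NonZero n}} : Set where
  field
    owner         : Assignment n m
    balanced      : Balanced owner
    slot          : Fin m → Maybe (Fin p)
    color         : Fin p → Fin m
    slot-color    : ∀ k → slot (color k) ≡ just k
    rival         : Fin n
    spare         : Fin m
    owner-spare   : owner spare ≡ rival
    rival-shallow : depth rival ≡ 0
    owner-deep    : ∀ {j k} → slot j ≡ just k → r < depth (owner j)

  owner≢rival : ∀ {j k} → slot j ≡ just k → owner j ≢ rival
  owner≢rival some eq = contradiction
    (subst (r <_) (trans (cong depth eq) rival-shallow) (owner-deep some)) λ ()

  open Contest owner balanced slot color slot-color rival spare owner-spare owner≢rival public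

  owner-inside : ∀ {l j k} → l ≤ r → slot j ≡ just k → inside l (owner j) ≡ true
  owner-inside {l} {j} l≤r some = dec-true (l <? depth (owner j)) (≤-<-trans l≤r (owner-deep some))

  matched : (α β : Fin p → ℕ) → Bool → Instance n m
  matched α β true  = contest α α
  matched α β false = contest β β

  contest-mixed : ∀ {α β l} → l ≤ r → ∀ i → contest α β i ≡ matched α β (inside l i) i
  contest-mixed {α} {β} {l} l≤r i with inside l i in eq
  ... | true  = contest-away {α} {β} {α} {i} λ i≡rival → contradiction
    (trans (sym eq) (trans (cong (inside l) i≡rival) (cong (λ x → does (l <? x)) rival-shallow))) λ ()
  ... | false = contest-unowned {α} {β} {β} {i} λ some owner≡i → contradiction
    (trans (sym (owner-inside l≤r some)) (trans (cong (inside l) owner≡i) eq)) λ ()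

module _ {n m p r : ℕ} .{{_ : NonTrivial n}} (A : SyncAlgorithm n m)
  (arena : Arena n m p r {{nonTrivial⇒nonZero n}}) where

  private instance
    n≢0 : NonZero n
    n≢0 = nonTrivial⇒nonZero n

  open Arena arena
  open Sync A
  open SyncRuns A
  open SyncAlgorithm A using (decision)

  -- The agents inside the cut decide as if α were matched, before they could
  -- learn that it is not.
  sync-fooled : ∀ {d} → SolvesInTime d → ∀ {α β k l t} → l ≤ r → α k < β k →
    AllDecided (decisions (run (contest α α) t)) →
    ¬ (∀ {s i d} → s < t → Crosses {n} l (i , d) →
       sent (run (contest α α) (suc s)) i d ≡ sent (run (contest β β) (suc s)) i d)
  sync-fooled solves {α} {β} {k} {l} {t} l≤r αk<βk done agree with proj₁ (solves (contest α β))
  ... | t′ , _ , done′ = mixed-run-fails {α} {β} {S = λ i → inside l i ≡ true} αk<βk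
    (owner-inside l≤r) (proj₂ (solves (contest α α)) t done)
    (proj₂ (solves (contest α β)) (t ⊔ t′) all-done) same
    where
    -- The mixed run is simulated only up to `t`, while agents outside the cut may decide as late as
    -- `t′`. At the later of both times all have decided, and those inside cannot have changed their
    -- minds.
    all-done : AllDecided (decisions (run (contest α β) (t ⊔ t′)))
    all-done i = just-decided (decision-stable (contest α β) i (m≤n⊔m t t′) (proj₂ (decided (done′ i))))
    same : ∀ i → inside l i ≡ true →
           decisions (run (contest α β) (t ⊔ t′)) i ≡ decisions (run (contest α α) t) i
    same i in-i with decided (done i)
    ... | S , eq = trans (decision-stable (contest α β) i (m≤m⊔n t t′) (trans (cong decision like-α) eq)) (sym eq)
      where
      like-α : state (run (contest α β) t) i ≡ state (run (contest α α) t) i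
      like-α = trans (proj₁ (mixed-run (inside l) (contest α β) (matched α β) (contest-mixed l≤r) t agree t ≤-refl i))
                     (cong (λ b → state (run (matched α β b) t) i) in-i)

-- Asynchronous runs

-- The amount removed is added on the left instead of being subtracted. Two nested uses account for
-- taking one message out of one queue.
∑-change : ∀ {k} {f g : Fin k → ℕ} i {a} → (∀ j → j ≢ i → f j ≡ g j) → a + f i ≡ g i → a + ∑ f ≡ ∑ g
∑-change {f = f} {g} zero {a} same eq = begin
  a + (f zero + ∑ (f ∘ suc)) ≡⟨ +-assoc a (f zero) _ ⟨
  a + f zero + ∑ (f ∘ suc)   ≡⟨ cong₂ _+_ eq (∑-cong λ j → same (suc j) λ ()) ⟩
  g zero + ∑ (g ∘ suc)       ∎
  where open ≡-Reasoning
∑-change {f = f} {g} (suc i) {a} same eq = begin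
  a + (f zero + ∑ (f ∘ suc)) ≡⟨ x∙yz≈y∙xz a (f zero) _ ⟩
  f zero + (a + ∑ (f ∘ suc)) ≡⟨ cong₂ _+_ (same zero λ ()) (∑-change i (λ j j≢i → same (suc j) λ { refl → j≢i refl }) eq) ⟩
  g zero + ∑ (g ∘ suc)       ∎
  where
  open ≡-Reasoning
  open import Algebra.Properties.CommutativeSemigroup +-commutativeSemigroup using (x∙yz≈y∙xz)

module AsyncRuns {n m : ℕ} .{{nt : NonTrivial n}} (A : AsyncAlgorithm n m) where
  open AsyncAlgorithm A
  open Async A

  private instance
    n≢0 : NonZero n
    n≢0 = nonTrivial⇒nonZero n

    2n≢0 : NonZero (n * 2)
    2n≢0 = m*n≢0 n 2

  -- One schedule serves as the worst case for every input and as the fair tail of every finite list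
  -- of events.
  roundRobin : Schedule
  roundRobin t = remQuot {n} 2 (t mod (n * 2))

  roundRobin-fair : Fair roundRobin
  roundRobin-fair (i , d) t = toℕ e + t * (n * 2) ,
    ≤-trans (m≤m*n t (n * 2)) (m≤n+m _ (toℕ e)) , (begin
    remQuot {n} 2 ((toℕ e + t * (n * 2)) mod (n * 2)) ≡⟨ cong (remQuot {n} 2) (toℕ-injective (begin
      toℕ ((toℕ e + t * (n * 2)) mod (n * 2))            ≡⟨ toℕ-fromℕ< _ ⟩
      (toℕ e + t * (n * 2)) % (n * 2)                    ≡⟨ [m+kn]%n≡m%n (toℕ e) t (n * 2) ⟩
      toℕ e % (n * 2)                                    ≡⟨ m<n⇒m%n≡m (toℕ<n e) ⟩
      toℕ e                                              ∎)) ⟩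
    remQuot {n} 2 e                                    ≡⟨ remQuot-combine i d ⟩
    i , d                                              ∎)
    where
    open ≡-Reasoning
    e : Fin (n * 2)
    e = combine i d

  reach : Instance n m → List Event → Config
  reach Q = foldr deliver (initial Q)

  -- The list has the last event first.
  play : List Event → Schedule
  play []       t = roundRobin t
  play (e ∷ es) t with <-cmp t (length es)
  ... | tri< _ _ _ = play es t
  ... | tri≈ _ _ _ = e
  ... | tri> _ _ _ = roundRobin t

  play-after : ∀ es t → length es ≤ t → play es t ≡ roundRobin t
  play-after []       t _  = refl
  play-after (e ∷ es) t le with <-cmp t (length es)
  ... | tri< _ _ ¬> = contradiction le ¬>
  ... | tri≈ _ _ ¬> = contradiction le ¬>
  ... | tri> _ _ _  = refl

  play-fair : ∀ es → Fair (play es)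
  play-fair es e t with roundRobin-fair e (t ⊔ length es)
  ... | t′ , le , eq = t′ , m⊔n≤o⇒m≤o t (length es) le ,
    trans (play-after es t′ (m⊔n≤o⇒n≤o t (length es) le)) eq

  run-cong : ∀ Q {σ τ} t → (∀ s → s < t → σ s ≡ τ s) → run Q σ t ≡ run Q τ t
  run-cong Q zero    _  = refl
  run-cong Q (suc t) eq = cong₂ deliver (eq t (n<1+n t)) (run-cong Q t λ s s<t → eq s (m<n⇒m<1+n s<t))

  -- Fairness concerns only the tail of a schedule. So every configuration reached by a finite list
  -- of events lies on a fair run, and what is required of fair runs applies to it.
  run-play : ∀ Q es → run Q (play es) (length es) ≡ reach Q es
  run-play Q []       = refl
  run-play Q (e ∷ es) = cong₂ deliver now (trans (run-cong Q (length es) before) (run-play Q es))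
    where
    now : play (e ∷ es) (length es) ≡ e
    now with <-cmp (length es) (length es)
    ... | tri< lt _ _ = contradiction lt (<-irrefl refl)
    ... | tri≈ _ _ _  = refl
    ... | tri> _ _ gt = contradiction gt (<-irrefl refl)
    before : ∀ s → s < length es → play (e ∷ es) s ≡ play es s
    before s lt with <-cmp s (length es)
    ... | tri< _ _ _  = refl
    ... | tri≈ ¬lt _ _ = contradiction lt ¬lt
    ... | tri> ¬lt _ _ = contradiction lt ¬lt

  deliver-[] : ∀ {C i d} → queue C i d ≡ [] → deliver (i , d) C ≡ C
  deliver-[] eq rewrite eq = refl

  module Delivery (C : Config) (i : Fin n) (d : Side) {msg : Message} {ms : List Message}
    (eq : queue C i d ≡ msg ∷ ms) where

    next : State × (Side → List Message)
    next = react i (state C i) d msg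

    remaining : Fin n → Side → List Message
    remaining = updateAt (queue C) i λ q → updateAt q d (const ms)

    deliver-state : state (deliver (i , d) C) ≡ updateAt (state C) i (const (proj₁ next))
    deliver-state rewrite eq = refl

    deliver-queue : ∀ k e → queue (deliver (i , d) C) k e ≡
      remaining k e ++ (if does (neighbour {n} e k ≟ i) then proj₂ next (opposite e) else [])
    deliver-queue k e rewrite eq = refl

    deliver-transmitted : transmitted (deliver (i , d) C) ≡
      transmitted C ++ concat (List.tabulate (proj₂ next))
    deliver-transmitted rewrite eq = refl

    remaining-here : remaining i d ≡ ms
    remaining-here = trans (cong (λ f → f d) (updateAt-updates i (queue C))) (updateAt-updates d (queue C i))

    remaining-elsewhere : ∀ k e → ¬ (k ≡ i × e ≡ d) → remaining k e ≡ queue C k e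
    remaining-elsewhere k e ne with k ≟ i
    ... | no  k≢i  = cong (λ f → f e) (updateAt-minimal k i (queue C) k≢i)
    ... | yes refl = trans (cong (λ f → f e) (updateAt-updates i (queue C)))
                           (updateAt-minimal e d (queue C i) λ e≡d → ne (refl , e≡d))

  heading : Event → List Message → List (Item n)
  heading e []        = []
  heading e (msg ∷ _) = (0 , e , msg) ∷ []

  -- Deliveries are recorded, not transmissions, since only a delivered message can influence the
  -- other side. The link is seen from the receiver.
  events : Instance n m → Schedule → ℕ → List (Item n)
  events Q σ zero    = []
  events Q σ (suc t) = events Q σ t ++ heading (σ t) (queue (run Q σ t) (proj₁ (σ t)) (proj₂ (σ t)))

  events-timely : ∀ Q σ t → All (λ (s , _) → s < 1) (events Q σ t)
  events-timely Q σ zero    = []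
  events-timely Q σ (suc t) = ++⁺ (events-timely Q σ t) (timely (queue (run Q σ t) (proj₁ (σ t)) (proj₂ (σ t))))
    where
    timely : ∀ q → All (λ (s , _) → s < 1) (heading (σ t) q)
    timely []      = []
    timely (_ ∷ _) = s≤s z≤n ∷ []

  module _ (c : ℕ) .{{_ : NonZero c}} where

    weight : List Message → ℕ
    weight = sumˡ ∘ List.map (basicMessages c n)

    weight-++ : ∀ xs ys → weight (xs ++ ys) ≡ weight xs + weight ys
    weight-++ xs ys = trans (cong sumˡ (map-++ (basicMessages c n) xs ys)) (sum-++ (List.map (basicMessages c n) xs) _)

    itemsWeight : List (Item n) → ℕ
    itemsWeight xs = sumˡ (List.map (λ (_ , _ , msg) → basicMessages c n msg) xs)

    itemsWeight-++ : ∀ xs ys → itemsWeight (xs ++ ys) ≡ itemsWeight xs + itemsWeight ys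
    itemsWeight-++ xs ys = trans (cong sumˡ (map-++ (λ (_ , _ , msg) → basicMessages c n msg) xs ys))
      (sum-++ (List.map (λ (_ , _ , msg) → basicMessages c n msg) xs) _)

    queued : Config → ℕ
    queued C = ∑ λ k → ∑ λ e → weight (queue C k e)

    private
      -- Each message that i sends enters one queue.
      arriving : ∀ i (out : Side → List Message) →
        let new = λ k e → if does (neighbour {n} e k ≟ i) then out (opposite e) else [] in
        ∑ (λ k → ∑ λ e → weight (new k e)) ≤ ∑ (weight ∘ out)
      arriving i out = begin
        ∑ (λ k → ∑ λ e → weight (new k e))   ≡⟨ ∑-comm +-0-commutativeMonoid (λ k e → weight (new k e)) ⟩
        ∑ (λ e → ∑ λ k → weight (new k e))   ≤⟨ ∑-mono-≤ {f = λ e → ∑ λ k → weight (new k e)} side ⟩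
        ∑ (λ e → weight (out (opposite e)))  ≡⟨ swap (weight (out left)) (weight (out right)) ⟩
        ∑ (weight ∘ out)                     ∎
        where
        open ≤-Reasoning
        new : Fin n → Side → List Message
        new k e = if does (neighbour {n} e k ≟ i) then out (opposite e) else []
        swap : ∀ a b → b + (a + 0) ≡ a + (b + 0)
        swap = solve-∀
        side : ∀ e → ∑ (λ k → weight (new k e)) ≤ weight (out (opposite e))
        side e = begin
          ∑ (λ k → weight (new k e))
            ≡⟨ ∑-cong (λ k → Bool.if-float weight (does (neighbour {n} e k ≟ i))) ⟩
          ∑ (λ k → if does (neighbour {n} e k ≟ i) then weight (out (opposite e)) else 0)
            ≡⟨ ∑-neighbour {n} e (λ j → if does (j ≟ i) then weight (out (opposite e)) else 0) ⟩
          ∑ (λ j → if does (j ≟ i) then weight (out (opposite e)) else 0)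
            ≤⟨ ∑-at-most-one (λ j → does (j ≟ i)) (toℕ i) (weight (out (opposite e))) only ⟩
          weight (out (opposite e)) ∎
          where
          only : ∀ j → does (j ≟ i) ≡ true → toℕ j ≡ toℕ i
          only j eq with j ≟ i
          ... | yes refl = refl

    initial-queued : ∀ Q → queued (initial Q) ≤ messagesSent c (initial Q)
    initial-queued Q = ≤-reflexive (begin
      ∑ (λ k → ∑ λ e → w (neighbour {n} e k) (opposite e))
        ≡⟨ ∑-comm +-0-commutativeMonoid (λ k e → w (neighbour {n} e k) (opposite e)) ⟩
      ∑ (λ e → ∑ λ k → w (neighbour {n} e k) (opposite e))
        ≡⟨ ∑-cong (λ e → ∑-neighbour {n} e (λ k → w k (opposite e))) ⟩
      ∑ (λ e → ∑ λ k → w k (opposite e))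
        ≡⟨ swap (∑ λ k → w k left) (∑ λ k → w k right) ⟩
      ∑ (λ e → ∑ λ k → w k e)
        ≡⟨ ∑-comm +-0-commutativeMonoid (λ e k → w k e) ⟩
      ∑ (λ k → ∑ λ e → w k e)
        ≡⟨ ∑-cong (λ k → sum-concat-tabulate (basicMessages c n) (out k)) ⟨
      ∑ (λ k → weight (concat (List.tabulate (out k))))
        ≡⟨ sum-concat-tabulate (basicMessages c n) (λ k → concat (List.tabulate (out k))) ⟨
      messagesSent c (initial Q) ∎)
      where
      open ≡-Reasoning
      out : Fin n → Side → List Message
      out k = proj₂ (start k (Q k))
      w : Fin n → Side → ℕ
      w k e = weight (out k e)
      swap : ∀ a b → b + (a + 0) ≡ a + (b + 0)
      swap = solve-∀

    deliver-queued : ∀ C i d {B} → B + queued C ≤ messagesSent c C →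
      B + itemsWeight (heading (i , d) (queue C i d)) + queued (deliver (i , d) C) ≤ messagesSent c (deliver (i , d) C)
    deliver-queued C i d {B} le = cases (queue C i d) refl
      where
      open ≤-Reasoning
      cases : ∀ q → queue C i d ≡ q →
        B + itemsWeight (heading (i , d) q) + queued (deliver (i , d) C) ≤ messagesSent c (deliver (i , d) C)
      cases []         eq rewrite deliver-[] {C} {i} {d} eq =
        subst (λ b → b + queued C ≤ messagesSent c C) (sym (+-identityʳ B)) le
      cases (msg ∷ ms) eq = begin
        B + (basicMessages c n msg + 0) + queued (deliver (i , d) C)
          ≡⟨ cong₂ (λ a b → B + a + b) (+-identityʳ (basicMessages c n msg)) split ⟩
        B + basicMessages c n msg + (∑ (λ k → ∑ (weight ∘ rem k)) + ∑ (λ k → ∑ (weight ∘ new k)))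
          ≡⟨ regroup B (basicMessages c n msg) _ _ ⟩
        B + (basicMessages c n msg + ∑ (λ k → ∑ (weight ∘ rem k))) + ∑ (λ k → ∑ (weight ∘ new k))
          ≡⟨ cong (λ a → B + a + ∑ (λ k → ∑ (weight ∘ new k))) removed ⟩
        B + queued C + ∑ (λ k → ∑ (weight ∘ new k))
          ≤⟨ +-mono-≤ le (arriving i out) ⟩
        messagesSent c C + ∑ (weight ∘ out)
          ≡⟨ cong (messagesSent c C +_) (sum-concat-tabulate (basicMessages c n) out) ⟨
        weight (transmitted C) + weight (concat (List.tabulate out))
          ≡⟨ weight-++ (transmitted C) (concat (List.tabulate out)) ⟨
        weight (transmitted C ++ concat (List.tabulate out))
          ≡⟨ cong weight (deliver-transmitted) ⟨
        messagesSent c (deliver (i , d) C) ∎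
        where
        open Delivery C i d eq
        out : Side → List Message
        out = proj₂ next
        rem new : Fin n → Side → List Message
        rem = remaining
        new k e = if does (neighbour {n} e k ≟ i) then out (opposite e) else []
        regroup : ∀ a b x y → a + b + (x + y) ≡ a + (b + x) + y
        regroup = solve-∀
        split : queued (deliver (i , d) C) ≡ ∑ (λ k → ∑ (weight ∘ rem k)) + ∑ (λ k → ∑ (weight ∘ new k))
        split = trans
          (∑-cong λ k → trans
            (∑-cong λ e → trans (cong weight (deliver-queue k e)) (weight-++ (rem k e) (new k e)))
            (∑-+ (weight ∘ rem k) (weight ∘ new k)))
          (∑-+ (λ k → ∑ (weight ∘ rem k)) (λ k → ∑ (weight ∘ new k)))
        removed : basicMessages c n msg + ∑ (λ k → ∑ (weight ∘ rem k)) ≡ queued C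
        removed = ∑-change i
          (λ k k≢i → ∑-cong λ e → cong weight (remaining-elsewhere k e (k≢i ∘ proj₁)))
          (∑-change d (λ e e≢d → cong weight (remaining-elsewhere i e (e≢d ∘ proj₂)))
            (trans (cong (λ q → basicMessages c n msg + weight q) remaining-here) (cong weight (sym eq))))

    -- The bound is not inductive by itself. The invariant adds the messages in transit: delivered
    -- and queued ones together weigh at most what was transmitted.
    events-cost : ∀ Q σ t → itemsWeight (events Q σ t) ≤ messagesSent c (run Q σ t)
    events-cost Q σ t = ≤-trans (m≤m+n _ (queued (run Q σ t))) (invariant t)
      where
      invariant : ∀ t → itemsWeight (events Q σ t) + queued (run Q σ t) ≤ messagesSent c (run Q σ t)
      invariant zero    = initial-queued Q
      invariant (suc t) = subst (λ b → b + queued (run Q σ (suc t)) ≤ messagesSent c (run Q σ (suc t)))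
        (sym (itemsWeight-++ (events Q σ t) _))
        (deliver-queued (run Q σ t) (proj₁ (σ t)) (proj₂ (σ t)) (invariant t))

    messagesSent-mono : ∀ Q σ {s t} → s ≤ t → messagesSent c (run Q σ s) ≤ messagesSent c (run Q σ t)
    messagesSent-mono Q σ {s} le = go (≤⇒≤′ le)
      where
      step : ∀ C i d → messagesSent c C ≤ messagesSent c (deliver (i , d) C)
      step C i d with queue C i d
      ... | []       = ≤-refl
      ... | msg ∷ ms = subst (messagesSent c C ≤_) (sym (weight-++ (transmitted C) _)) (m≤m+n _ _)
      go : ∀ {t} → s ≤′ t → messagesSent c (run Q σ s) ≤ messagesSent c (run Q σ t)
      go (≤′-reflexive refl)    = ≤-refl
      go (≤′-step {n = t} le) = ≤-trans (go le) (step (run Q σ t) (proj₁ (σ t)) (proj₂ (σ t)))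

-- Merging asynchronous executions

module Merging {n m : ℕ} .{{nt : NonTrivial n}} (A : AsyncAlgorithm n m) (side : Fin n → Bool) where
  open AsyncAlgorithm A
  open Async A
  open AsyncRuns A

  private instance
    n≢0 : NonZero n
    n≢0 = nonTrivial⇒nonZero n

  -- A message in transit belongs to the side of its sender.
  record Agree (b : Bool) (C C′ : Config) : Set where
    field
      states : ∀ i → side i ≡ b → state C i ≡ state C′ i
      queues : ∀ i d → side (neighbour d i) ≡ b → queue C i d ≡ queue C′ i d

  open Agree

  agree-refl : ∀ {b C} → Agree b C C
  agree-refl = record { states = λ _ _ → refl ; queues = λ _ _ _ → refl }

  agree-sym : ∀ {b C C′} → Agree b C C′ → Agree b C′ C
  agree-sym ag = record { states = λ i eq → sym (states ag i eq) ; queues = λ i d eq → sym (queues ag i d eq) }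

  agree-trans : ∀ {b C C′ C″} → Agree b C C′ → Agree b C′ C″ → Agree b C C″
  agree-trans ag ag′ = record
    { states = λ i eq → trans (states ag i eq) (states ag′ i eq)
    ; queues = λ i d eq → trans (queues ag i d eq) (queues ag′ i d eq) }

  -- Only the heads of the queues have to match. If the sender is on the other side, the rest of the
  -- queue is not compared by `Agree b`.
  agree-deliver : ∀ {b C C′ i d msg ms ms′} → queue C i d ≡ msg ∷ ms → queue C′ i d ≡ msg ∷ ms′ →
                  Agree b C C′ → Agree b (deliver (i , d) C) (deliver (i , d) C′)
  agree-deliver {b} {C} {C′} {i} {d} {msg} {ms} {ms′} eq eq′ ag = record
    { states = λ k side≡ → begin
        state (deliver (i , d) C) k                ≡⟨ cong (λ f → f k) D.deliver-state ⟩
        updateAt (state C) i (const (proj₁ D.next)) k     ≡⟨ new-state k side≡ (k ≟ i) ⟩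
        updateAt (state C′) i (const (proj₁ D′.next)) k   ≡⟨ cong (λ f → f k) D′.deliver-state ⟨
        state (deliver (i , d) C′) k               ∎
    ; queues = λ k e side≡ → begin
        queue (deliver (i , d) C) k e              ≡⟨ D.deliver-queue k e ⟩
        D.remaining k e ++ (if does (neighbour {n} e k ≟ i) then proj₂ D.next (opposite e) else [])
          ≡⟨ cong₂ _++_ (rest k e side≡) (fresh k e side≡) ⟩
        D′.remaining k e ++ (if does (neighbour {n} e k ≟ i) then proj₂ D′.next (opposite e) else [])
          ≡⟨ D′.deliver-queue k e ⟨
        queue (deliver (i , d) C′) k e             ∎
    }
    where
    open ≡-Reasoning
    module D = Delivery C i d eq
    module D′ = Delivery C′ i d eq′
    next≡ : side i ≡ b → D.next ≡ D′.next
    next≡ side≡ = cong (λ s → react i s d msg) (states ag i side≡)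
    new-state : ∀ k → side k ≡ b → Dec (k ≡ i) →
      updateAt (state C) i (const (proj₁ D.next)) k ≡ updateAt (state C′) i (const (proj₁ D′.next)) k
    new-state k side≡ (yes refl) = trans (updateAt-updates k (state C))
      (trans (cong proj₁ (next≡ side≡)) (sym (updateAt-updates k (state C′))))
    new-state k side≡ (no k≢i) = trans (updateAt-minimal k i (state C) k≢i)
      (trans (states ag k side≡) (sym (updateAt-minimal k i (state C′) k≢i)))
    fresh : ∀ k e → side (neighbour e k) ≡ b →
      (if does (neighbour {n} e k ≟ i) then proj₂ D.next (opposite e) else []) ≡
      (if does (neighbour {n} e k ≟ i) then proj₂ D′.next (opposite e) else [])
    fresh k e side≡ with neighbour {n} e k ≟ i
    ... | yes refl = cong (λ nx → proj₂ nx (opposite e)) (next≡ side≡)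
    ... | no _     = refl
    rest : ∀ k e → side (neighbour e k) ≡ b → D.remaining k e ≡ D′.remaining k e
    rest k e side≡ with (k ≟ i) ×-dec (e ≟ d)
    ... | yes (refl , refl) = trans D.remaining-here (trans
      (∷-injectiveʳ (trans (sym eq) (trans (queues ag k e side≡) eq′))) (sym D′.remaining-here))
    ... | no ne = trans (D.remaining-elsewhere k e ne)
      (trans (queues ag k e side≡) (sym (D′.remaining-elsewhere k e ne)))

  -- A delivery touches the receiver's state, the queue from its sender and the queues that the
  -- receiver fills; all of them belong to the other side.
  agree-foreign : ∀ {b C i d} → side i ≡ not b → side (neighbour d i) ≡ not b → Agree b C (deliver (i , d) C)
  agree-foreign {b} {C} {i} {d} i-out j-out = cases (queue C i d) refl
    where
    cases : ∀ q → queue C i d ≡ q → Agree b C (deliver (i , d) C)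
    cases [] eq rewrite deliver-[] {C} {i} {d} eq = agree-refl
    cases (msg ∷ ms) eq = record
      { states = λ k side≡ → sym (trans (cong (λ f → f k) deliver-state)
          (updateAt-minimal k i (state C) λ { refl → Bool.not-¬ side≡ i-out }))
      ; queues = λ k e side≡ → sym (begin
          queue (deliver (i , d) C) k e
            ≡⟨ deliver-queue k e ⟩
          remaining k e ++ (if does (neighbour {n} e k ≟ i) then proj₂ next (opposite e) else [])
            ≡⟨ cong (λ b → remaining k e ++ (if b then proj₂ next (opposite e) else []))
                 (dec-false (neighbour {n} e k ≟ i) λ eq → Bool.not-¬ (trans (cong side (sym eq)) side≡) i-out) ⟩
          remaining k e ++ []
            ≡⟨ ++-identityʳ (remaining k e) ⟩
          remaining k e
            ≡⟨ remaining-elsewhere k e (λ { (refl , refl) → Bool.not-¬ side≡ j-out }) ⟩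
          queue C k e ∎)
      }
      where
      open ≡-Reasoning
      open Delivery C i d eq

  record Joint (b : Bool) (C C₁ C₂ : Config) : Set where
    constructor joint
    field
      near    : Agree b C C₁
      distant : Agree (not b) C C₂

  joint-swap : ∀ {b C C₁ C₂} → Joint b C C₁ C₂ → Joint (not b) C C₂ C₁
  joint-swap {b} (joint ag ag′) = joint ag′ (subst (λ b → Agree b _ _) (sym (Bool.not-involutive b)) ag)

  Crossing : Event → Set
  Crossing (i , d) = side i ≢ side (neighbour d i)

  crossing? : Decidable Crossing
  crossing? (i , d) = ¬? (side i Bool.≟ side (neighbour d i))

  -- An event that does not carry a message across the cut is simulated by
  -- itself or, if it is on the other side, by no event.
  quiet-step : ∀ {Q b C C₁ C₂} e → queue C₁ (proj₁ e) (proj₂ e) ≡ [] ⊎ ¬ Crossing e →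
    Joint b C C₁ C₂ → (∃[ es ] C ≡ reach Q es) →
    ∃[ C′ ] Joint b C′ (deliver e C₁) C₂ × (∃[ es ] C′ ≡ reach Q es)
  -- Nothing happens in `C₁`, but `C` may have a message there if the sender is distant, so the
  -- event is left out.
  quiet-step {C = C} {C₁} {C₂} (i , d) (inj₁ empty) J R =
    C , subst (λ D → Joint _ C D C₂) (sym (deliver-[] {C₁} {i} {d} empty)) J , R
  quiet-step {Q} {b} {C} {C₁} {C₂} (i , d) (inj₂ ¬cr) (joint ag ag′) (es , C≡)
    with side i Bool.≟ side (neighbour d i)
  ... | no  ne   = contradiction ne ¬cr
  ... | yes same with side i Bool.≟ b
  ...   | no side≢b = C , joint (agree-trans ag (agree-foreign i-out (trans (sym same) i-out))) ag′ , es , C≡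
    where
    i-out : side i ≡ not b
    i-out = Bool.¬-not side≢b
  ...   | yes side≡b = deliver (i , d) C ,
      joint (stepped (queue C₁ i d) refl) (agree-trans (agree-sym (agree-foreign
        (trans side≡b (sym (Bool.not-involutive b))) (trans (sym same) (trans side≡b (sym (Bool.not-involutive b))))))
        ag′) ,
      (i , d) ∷ es , cong (deliver (i , d)) C≡
    where
    q≡ : queue C i d ≡ queue C₁ i d
    q≡ = queues ag i d (trans (sym same) side≡b)
    stepped : ∀ q → queue C₁ i d ≡ q → Agree b (deliver (i , d) C) (deliver (i , d) C₁)
    stepped []         eq = subst₂ (Agree b)
      (sym (deliver-[] {C} {i} {d} (trans q≡ eq))) (sym (deliver-[] {C₁} {i} {d} eq)) ag
    stepped (msg ∷ ms) eq = agree-deliver (trans q≡ eq) eq ag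

  -- The queue of `C` is that of `C₁` or of `C₂`, depending on the sender's side. As both begin with
  -- `msg`, so does it, and one delivery simulates both.
  crossing-step : ∀ {b C C₁ C₂ i d msg ms₁ ms₂} → queue C₁ i d ≡ msg ∷ ms₁ → queue C₂ i d ≡ msg ∷ ms₂ →
    Joint b C C₁ C₂ → Joint b (deliver (i , d) C) (deliver (i , d) C₁) (deliver (i , d) C₂)
  crossing-step {b} {C} {C₁} {C₂} {i} {d} {msg} eq₁ eq₂ (joint ag ag′) =
    joint (agree-deliver (proj₂ pending) eq₁ ag) (agree-deliver (proj₂ pending) eq₂ ag′)
    where
    pending : ∃[ ms ] queue C i d ≡ msg ∷ ms
    pending with side (neighbour d i) Bool.≟ b
    ... | yes eq = _ , trans (queues ag i d eq) eq₁
    ... | no  ne = _ , trans (queues ag′ i d (Bool.¬-not ne)) eq₂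

  trace : Instance n m → Schedule → ℕ → List (Item n)
  trace Q σ t = filter (crossing? ∘ link) (events Q σ t)

  classify : ∀ Q σ t → let C = run Q σ t ; e = σ t ; q = queue C (proj₁ e) (proj₂ e) in
    (trace Q σ (suc t) ≡ trace Q σ t × (q ≡ [] ⊎ ¬ Crossing e)) ⊎
    (∃₂ λ msg ms → q ≡ msg ∷ ms × trace Q σ (suc t) ≡ trace Q σ t ∷ʳ (0 , e , msg))
  classify Q σ t with queue (run Q σ t) (proj₁ (σ t)) (proj₂ (σ t))
  ... | [] = inj₁ (trans (filter-++ (crossing? ∘ link) (events Q σ t) []) (++-identityʳ _) , inj₁ refl)
  ... | msg ∷ ms with crossing? (σ t)
  ...   | no ¬cr = inj₁ (trans (filter-++ (crossing? ∘ link) (events Q σ t) _)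
            (trans (cong (trace Q σ t ++_) (filter-reject (crossing? ∘ link) ¬cr)) (++-identityʳ _)) , inj₂ ¬cr)
  ...   | yes cr = inj₂ (msg , ms , refl , trans (filter-++ (crossing? ∘ link) (events Q σ t) _)
            (cong (trace Q σ t ++_) (filter-accept (crossing? ∘ link) cr)))

  module _ (Q : Instance n m) (Q̂ : Bool → Instance n m) (mixed : ∀ i → Q i ≡ Q̂ (side i) i) (σ : Schedule) where

    initial-joint : Joint true (initial Q) (initial (Q̂ true)) (initial (Q̂ false))
    initial-joint = joint (agree true) (agree false)
      where
      like : ∀ {b i} → side i ≡ b → start i (Q i) ≡ start i (Q̂ b i)
      like refl = cong (start _) (mixed _)
      agree : ∀ b → Agree b (initial Q) (initial (Q̂ b))
      agree b = record
        { states = λ i eq → cong proj₁ (like eq)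
        ; queues = λ i d eq → cong (λ s → proj₂ s (opposite d)) (like eq) }

    Merged : ℕ → ℕ → Set
    Merged t₁ t₂ = ∃[ C ] Joint true C (run (Q̂ true) σ t₁) (run (Q̂ false) σ t₂) × (∃[ es ] C ≡ reach Q es)

    -- Quiet events at the end of either execution are removed separately. Once both end with a
    -- crossing delivery, equal traces force the same link and message, and the two are performed as
    -- one event.
    merge : ∀ t₁ t₂ → trace (Q̂ true) σ t₁ ≡ trace (Q̂ false) σ t₂ → Merged t₁ t₂
    merge zero zero _ = initial Q , initial-joint , [] , refl
    merge zero (suc t₂) same with classify (Q̂ false) σ t₂
    ... | inj₂ (_ , _ , _ , snoc) = contradiction (++-conicalʳ (trace (Q̂ false) σ t₂) (_ ∷ []) (sym (trans same snoc))) λ ()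
    ... | inj₁ (unchanged , quiet) with merge zero t₂ (trans same unchanged)
    ...   | C , J , R with quiet-step (σ t₂) quiet (joint-swap J) R
    ...     | C′ , J′ , R′ = C′ , joint-swap J′ , R′
    merge (suc t₁) t₂ same with classify (Q̂ true) σ t₁
    ... | inj₁ (unchanged , quiet) with merge t₁ t₂ (trans (sym unchanged) same)
    ...   | C , J , R = quiet-step (σ t₁) quiet J R
    merge (suc t₁) zero same | inj₂ (_ , _ , _ , snoc) =
      contradiction (++-conicalʳ (trace (Q̂ true) σ t₁) (_ ∷ []) (trans (sym snoc) same)) λ ()
    merge (suc t₁) (suc t₂) same | inj₂ (msg₁ , ms₁ , eq₁ , snoc₁) with classify (Q̂ false) σ t₂
    ... | inj₁ (unchanged , quiet) with merge (suc t₁) t₂ (trans same unchanged)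
    ...   | C , J , R with quiet-step (σ t₂) quiet (joint-swap J) R
    ...     | C′ , J′ , R′ = C′ , joint-swap J′ , R′
    merge (suc t₁) (suc t₂) same | inj₂ (msg₁ , ms₁ , eq₁ , snoc₁) | inj₂ (msg₂ , ms₂ , eq₂ , snoc₂)
      with ∷ʳ-injective (trace (Q̂ true) σ t₁) (trace (Q̂ false) σ t₂) (trans (sym snoc₁) (trans same snoc₂))
    ... | same′ , item≡ with merge t₁ t₂ same′
    ...   | C , J , es , C≡ = deliver (σ t₁) C , both (σ t₂) (cong link item≡) (cong (proj₂ ∘ proj₂) item≡) eq₂ ,
              σ t₁ ∷ es , cong (deliver (σ t₁)) C≡
      where
      both : ∀ e → σ t₁ ≡ e → msg₁ ≡ msg₂ → queue (run (Q̂ false) σ t₂) (proj₁ e) (proj₂ e) ≡ msg₂ ∷ ms₂ →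
        Joint true (deliver (σ t₁) C) (deliver (σ t₁) (run (Q̂ true) σ t₁)) (deliver e (run (Q̂ false) σ t₂))
      both _ refl refl eq = crossing-step eq₁ eq J

module _ {n m p r : ℕ} .{{_ : NonTrivial n}} (A : AsyncAlgorithm n m)
  (arena : Arena n m p r {{nonTrivial⇒nonZero n}}) where

  private instance
    n≢0 : NonZero n
    n≢0 = nonTrivial⇒nonZero n

  open Arena arena
  open Async A
  open AsyncRuns A
  open AsyncAlgorithm A using (decision)

  -- The merged configuration is complete at once: inside the cut all have decided as in the first
  -- execution, outside as in the second. Hence both executions must be finished, but not at the
  -- same time.
  async-fooled : Solves → ∀ {α β k l t₁ t₂} → l ≤ r → α k < β k →
    AllDecided (decisions (run (contest α α) roundRobin t₁)) →
    AllDecided (decisions (run (contest β β) roundRobin t₂)) →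
    filter (crosses? l ∘ link) (events (contest α α) roundRobin t₁) ≢
    filter (crosses? l ∘ link) (events (contest β β) roundRobin t₂)
  async-fooled solves {α} {β} {k} {l} {t₁} {t₂} l≤r αk<βk done₁ done₂ same
    with merge (contest α β) (matched α β) (contest-mixed l≤r) roundRobin t₁ t₂ same
    where open Merging A (inside l)
  ... | C , J , es , C≡ = mixed-run-fails {α} {β} {S = λ i → inside l i ≡ true} αk<βk (owner-inside l≤r)
      (proj₂ (solves (contest α α) roundRobin roundRobin-fair) t₁ done₁)
      (subst (Correct (contest α β) ∘ decisions) run≡
        (proj₂ (solves (contest α β) (play es) (play-fair es)) (length es)
          (subst (AllDecided ∘ decisions) (sym run≡) done)))
      (λ i in-i → cong decision (states (near J) i in-i))
    where
    open Merging A (inside l)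
    open Merging.Agree
    open Merging.Joint
    run≡ : run (contest α β) (play es) (length es) ≡ C
    run≡ = trans (run-play (contest α β) es) (sym C≡)
    done : AllDecided (decisions C)
    done i with inside l i in eq
    ... | true  = just-decided (trans (cong decision (states (near J) i eq)) (proj₂ (decided (done₁ i))))
    ... | false = just-decided (trans (cong decision (states (distant J) i eq)) (proj₂ (decided (done₂ i))))

-- The contested colors

∑-ones : ∀ k → ∑ {k} (λ _ → 1) ≡ k
∑-ones zero    = refl
∑-ones (suc k) = cong suc (∑-ones k)

-- Every agent owns q₁ + 1 colors, in blocks, and the first s agents own one
-- more. The colors of the blocks of h consecutive agents, as far from the rival
-- as possible, are contested.
module Blocks (r h q₁ s : ℕ) (s≤n : s ≤ suc r + (h + r)) where

  n q m p : ℕ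
  n = suc r + (h + r)
  q = suc q₁
  m = n * q + s
  p = h * q

  blockOwner : Fin (n * q) ⊎ Fin s → Fin n
  blockOwner (inj₁ a) = proj₁ (remQuot {n} q a)
  blockOwner (inj₂ v) = inject≤ v s≤n

  owner : Assignment n m
  owner j = blockOwner (splitAt (n * q) j)

  -- These are exactly the agents at distance more than `r` from agent 0: `suc r` positions precede
  -- them and `r` follow.
  far : Fin h → Fin n
  far x = suc r ↑ʳ (x ↑ˡ r)

  far⁻¹ : Fin n → Maybe (Fin h)
  far⁻¹ i with splitAt (suc r) i
  ... | inj₁ _ = nothing
  ... | inj₂ y with splitAt h y
  ...   | inj₁ x = just x
  ...   | inj₂ _ = nothing

  far⁻¹-far : ∀ x → far⁻¹ (far x) ≡ just x
  far⁻¹-far x rewrite splitAt-↑ʳ (suc r) (h + r) (x ↑ˡ r) | splitAt-↑ˡ h x r = refl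

  far⁻¹-deep : ∀ i {x} → far⁻¹ i ≡ just x → r < depth i
  far⁻¹-deep i eq with splitAt (suc r) i in eq₁
  ... | inj₂ y with splitAt h y in eq₂
  ...   | inj₁ x = subst (λ i → r < depth i) (splitAt⁻¹-↑ʳ eq₁) (subst (λ t → r < t ⊓ (n ∸ t)) (sym (toℕ-↑ʳ (suc r) y))
    (⊓-glb (m≤m+n (suc r) (toℕ y)) (subst (λ t → suc r ≤ n ∸ (suc r + t))
      (trans (sym (toℕ-↑ˡ x r)) (cong toℕ (splitAt⁻¹-↑ˡ eq₂)))
      (subst (suc r ≤_) (sym ([m+n]∸[m+o]≡n∸o (suc r) (h + r) (toℕ x))) remains))))
    where
    remains : suc r ≤ h + r ∸ toℕ x
    remains = m+n≤o⇒m≤o∸n (suc r) (subst (_≤ h + r) (cong suc (+-comm (toℕ x) r)) (+-monoˡ-≤ r (toℕ<n x)))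

  blockSlot : Fin n × Fin q → Maybe (Fin p)
  blockSlot (i , u) = Maybe.map (λ x → combine x u) (far⁻¹ i)

  slotAt : Fin (n * q) ⊎ Fin s → Maybe (Fin p)
  slotAt (inj₁ a) = blockSlot (remQuot {n} q a)
  slotAt (inj₂ _) = nothing

  slot : Fin m → Maybe (Fin p)
  slot j = slotAt (splitAt (n * q) j)

  color : Fin p → Fin m
  color k = combine (far (proj₁ (remQuot {h} q k))) (proj₂ (remQuot {h} q k)) ↑ˡ s

  slot-color : ∀ k → slot (color k) ≡ just k
  slot-color k = begin
    slotAt (splitAt (n * q) (combine (far x) u ↑ˡ s)) ≡⟨ cong slotAt (splitAt-↑ˡ (n * q) (combine (far x) u) s) ⟩
    blockSlot (remQuot {n} q (combine (far x) u))      ≡⟨ cong blockSlot (remQuot-combine (far x) u) ⟩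
    Maybe.map (λ x → combine x u) (far⁻¹ (far x))      ≡⟨ cong (Maybe.map (λ x → combine x u)) (far⁻¹-far x) ⟩
    just (combine x u)                                 ≡⟨ cong just (combine-remQuot {h} q k) ⟩
    just k                                             ∎
    where
    open ≡-Reasoning
    x = proj₁ (remQuot {h} q k)
    u = proj₂ (remQuot {h} q k)

  owner-deep : ∀ {j k} → slot j ≡ just k → r < depth (owner j)
  owner-deep {j} = deep (splitAt (n * q) j)
    where
    deep : ∀ x {k} → slotAt x ≡ just k → r < depth (blockOwner x)
    deep (inj₁ a) eq with far⁻¹ (proj₁ (remQuot {n} q a)) in eq′
    ... | just x = far⁻¹-deep (proj₁ (remQuot {n} q a)) eq′

  size-owner : ∀ i → ∣ colorsOf owner i ∣ ≡ q + ∑ (λ v → if does (inject≤ v s≤n ≟ i) then 1 else 0)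
  size-owner i = begin
    ∣ colorsOf owner i ∣
      ≡⟨ size-tabulate (λ j → does (owner j ≟ i)) ⟩
    ∑ (λ j → if does (owner j ≟ i) then 1 else 0)
      ≡⟨ ∑-↑ (n * q) (λ j → if does (owner j ≟ i) then 1 else 0) ⟩
    ∑ (λ a → if does (owner (a ↑ˡ s) ≟ i) then 1 else 0) + ∑ (λ v → if does (owner (n * q ↑ʳ v) ≟ i) then 1 else 0)
      ≡⟨ cong₂ _+_ blocks (∑-cong λ v → cong (λ x → if does (blockOwner x ≟ i) then 1 else 0) (splitAt-↑ʳ (n * q) s v)) ⟩
    q + ∑ (λ v → if does (inject≤ v s≤n ≟ i) then 1 else 0) ∎
    where
    open ≡-Reasoning
    blocks : ∑ (λ a → if does (owner (a ↑ˡ s) ≟ i) then 1 else 0) ≡ q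
    blocks = begin
      ∑ (λ a → if does (owner (a ↑ˡ s) ≟ i) then 1 else 0)
        ≡⟨ ∑-combine n (λ a → if does (owner (a ↑ˡ s) ≟ i) then 1 else 0) ⟩
      ∑ {n} (λ x → ∑ {q} λ u → if does (owner (combine x u ↑ˡ s) ≟ i) then 1 else 0)
        ≡⟨ ∑-cong {n} (λ x → ∑-cong {q} λ u → cong (λ y → if does (y ≟ i) then 1 else 0) (owner-combine x u)) ⟩
      ∑ (λ x → ∑ {q} λ u → if does (x ≟ i) then 1 else 0)
        ≡⟨ ∑-comm +-0-commutativeMonoid (λ (x : Fin n) (u : Fin q) → if does (x ≟ i) then 1 else 0) ⟩
      ∑ {q} (λ u → ∑ λ x → if does (x ≟ i) then 1 else 0)
        ≡⟨ ∑-cong {q} (λ u → ∑-indicator i) ⟩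
      ∑ {q} (λ u → 1)
        ≡⟨ ∑-ones q ⟩
      q ∎
      where
      owner-combine : ∀ (x : Fin n) (u : Fin q) → owner (combine x u ↑ˡ s) ≡ x
      owner-combine x u = trans (cong blockOwner (splitAt-↑ˡ (n * q) (combine x u) s)) (cong proj₁ (remQuot-combine x u))

  size-extra : ∀ i → ∑ (λ v → if does (inject≤ v s≤n ≟ i) then 1 else 0) ≤ 1
  size-extra i = ∑-at-most-one (λ v → does (inject≤ v s≤n ≟ i)) (toℕ i) 1 only
    where
    only : ∀ v → does (inject≤ v s≤n ≟ i) ≡ true → toℕ v ≡ toℕ i
    only v eq with inject≤ v s≤n ≟ i
    ... | yes refl = sym (toℕ-inject≤ v s≤n)

  balanced : s < n → Balanced owner
  balanced s<n i = subst (m / n ≤_) (sym (size-owner i)) (≤-trans lower (m≤m+n q _)) ,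
    subst (_≤ ⌈ m / n ⌉) (sym (size-owner i)) 
      (upper (∑ (λ v → if does (inject≤ v s≤n ≟ i) then 1 else 0)) (size-extra i) (∑-bounded {f = λ v → if does (inject≤ v s≤n ≟ i) then 1 else 0} λ v → indicator≤1 (does (inject≤ v s≤n ≟ i))))
    where
    open ≤-Reasoning
    indicator≤1 : ∀ b → (if b then 1 else 0) ≤ 1
    indicator≤1 true  = ≤-refl
    indicator≤1 false = z≤n
    lower : m / n ≤ q
    lower = s≤s⁻¹ (m<n*o⇒m/o<n (begin-strict
      n * q + s   <⟨ +-monoʳ-< (n * q) s<n ⟩
      n * q + n   ≡⟨ trans (+-comm (n * q) n) (sym (*-suc n q)) ⟩
      n * suc q   ≡⟨ *-comm n (suc q) ⟩
      suc q * n   ∎))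
    reaches : ∀ a → a * n ≤ m + pred n → a ≤ ⌈ m / n ⌉
    reaches a le = subst (_≤ ⌈ m / n ⌉) (m*n/n≡m a n) (/-monoˡ-≤ n le)
    -- If some agent has an extra color then `s` is positive, and the ceiling reaches `q + 1`.
    upper : ∀ e → e ≤ 1 → e ≤ s * 1 → q + e ≤ ⌈ m / n ⌉
    upper zero          _ _  = reaches (q + 0) (begin
      (q + 0) * n     ≡⟨ trans (cong (_* n) (+-identityʳ q)) (*-comm q n) ⟩
      n * q           ≤⟨ m≤m+n (n * q) s ⟩
      m               ≤⟨ m≤m+n m (pred n) ⟩
      m + pred n      ∎)
    upper (suc zero)    _ 1≤s = reaches (q + 1) (begin
      (q + 1) * n      ≡⟨ regroup q (pred n) ⟩
      n * q + 1 + pred n ≤⟨ +-monoˡ-≤ (pred n) (+-monoʳ-≤ (n * q) (subst (1 ≤_) (*-identityʳ s) 1≤s)) ⟩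
      m + pred n       ∎)
      where
      regroup : ∀ q k → (q + 1) * suc k ≡ suc k * q + 1 + k
      regroup = solve-∀
    upper (suc (suc _)) (s≤s ()) _

  arena : s < n → Arena n m p r
  arena s<n = record
    { owner         = owner
    ; balanced      = balanced s<n
    ; slot          = slot
    ; color         = color
    ; slot-color    = slot-color
    ; rival         = zero
    -- The first color of the rival's own block, which has `suc q₁` colors and so is not empty.
    ; spare         = combine {n} zero zero ↑ˡ s
    ; owner-spare   = trans (cong blockOwner (splitAt-↑ˡ (n * q) (combine {n} zero zero) s))
                            (cong proj₁ (remQuot-combine {n} {q} zero zero))
    ; rival-shallow = refl
    ; owner-deep    = λ {j} → owner-deep {j}
    }

-- Numbering the vectors of amounts; logarithms and the weight of a message

funToFin-cong : ∀ {a b} {f g : Fin a → Fin b} → (∀ k → f k ≡ g k) → funToFin f ≡ funToFin g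
funToFin-cong {zero}  eq = refl
funToFin-cong {suc a} eq = cong₂ combine (eq zero) (funToFin-cong (eq ∘ suc))

-- The number `z` read as `p` digits in base `2 ^ v`, so that inputs are counted directly in bits.
amounts : ∀ v p → Fin (2 ^ (v * p)) → Fin p → ℕ
amounts v p z k = toℕ (finToFun {2 ^ v} {p} (cast (sym (^-*-assoc 2 v p)) z) k)

amounts-bounded : ∀ v p z k → amounts v p z k ≤ pred (2 ^ v)
amounts-bounded v p z k = <⇒≤pred (toℕ<n (finToFun {2 ^ v} {p} (cast (sym (^-*-assoc 2 v p)) z) k))

amounts-differ : ∀ v p {z z′} → z ≢ z′ → ∃[ k ] amounts v p z k ≢ amounts v p z′ k
amounts-differ v p {z} {z′} z≢z′ = ¬∀⟶∃¬ p (λ k → amounts v p z k ≡ amounts v p z′ k)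
  (λ k → amounts v p z k ℕ.≟ amounts v p z′ k) λ same → z≢z′ (cast-injective (begin
    coded z                              ≡⟨ funToFin-finToFin {p} {2 ^ v} (coded z) ⟨
    funToFin (finToFun {2 ^ v} {p} (coded z)) ≡⟨ funToFin-cong (λ k → toℕ-injective (same k)) ⟩
    funToFin (finToFun {2 ^ v} {p} (coded z′)) ≡⟨ funToFin-finToFin {p} {2 ^ v} (coded z′) ⟩
    coded z′                             ∎))
  where
  open ≡-Reasoning
  coded : Fin (2 ^ (v * p)) → Fin ((2 ^ v) ^ p)
  coded = cast (sym (^-*-assoc 2 v p))
  cast-injective : ∀ {x y} → coded x ≡ coded y → x ≡ y
  cast-injective {x} {y} eq = toℕ-injective (trans (sym (toℕ-cast _ x)) (trans (cong toℕ eq) (toℕ-cast _ y)))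

n≤2^⌈log₂n⌉ : ∀ n → n ≤ 2 ^ ⌈log₂ n ⌉
n≤2^⌈log₂n⌉ = <-rec (λ n → n ≤ 2 ^ ⌈log₂ n ⌉) bound
  where
  open ≤-Reasoning
  bound : ∀ n → (∀ {k} → k < n → k ≤ 2 ^ ⌈log₂ k ⌉) → n ≤ 2 ^ ⌈log₂ n ⌉
  bound 0 _ = z≤n
  bound 1 _ = ≤-refl
  bound n@(suc (suc k)) rec = begin
    n                              ≡⟨ ⌊n/2⌋+⌈n/2⌉≡n n ⟨
    ⌊ n /2⌋ + ⌈ n /2⌉              ≤⟨ +-monoˡ-≤ ⌈ n /2⌉ (⌊n/2⌋≤⌈n/2⌉ n) ⟩
    ⌈ n /2⌉ + ⌈ n /2⌉              ≡⟨ cong (⌈ n /2⌉ +_) (+-identityʳ ⌈ n /2⌉) ⟨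
    2 * ⌈ n /2⌉                    ≤⟨ *-monoʳ-≤ 2 (rec (⌈n/2⌉<n k)) ⟩
    2 * 2 ^ ⌈log₂ ⌈ n /2⌉ ⌉        ≡⟨ cong (λ l → 2 * 2 ^ l) (⌈log₂⌈n/2⌉⌉≡⌈log₂n⌉∸1 n) ⟩
    2 * 2 ^ (⌈log₂ n ⌉ ∸ 1)        ≡⟨ cong (2 ^_) (m+[n∸m]≡n {1} (⌈log₂⌉-mono-≤ {2} {n} (s≤s (s≤s z≤n)))) ⟩
    2 ^ ⌈log₂ n ⌉                  ∎

n≤⌈n/b⌉*b : ∀ a b .{{_ : NonZero b}} → a ≤ ⌈ a / b ⌉ * b
n≤⌈n/b⌉*b a b = +-cancelˡ-≤ (pred b) a (⌈ a / b ⌉ * b) (begin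
  pred b + a                                       ≡⟨ +-comm (pred b) a ⟩
  a + pred b                                       ≡⟨ m≡m%n+[m/n]*n (a + pred b) b ⟩
  (a + pred b) % b + ⌈ a / b ⌉ * b                 ≤⟨ +-monoˡ-≤ _ (<⇒≤pred (m%n<n (a + pred b) b)) ⟩
  pred b + ⌈ a / b ⌉ * b                           ∎)
  where open ≤-Reasoning

module _ (c n : ℕ) .{{_ : NonZero c}} .{{_ : NonTrivial n}} (msg : Message) where

  private
    capacity≢0 : NonZero (c * ⌈log₂ n ⌉)
    capacity≢0 = m*n≢0 c ⌈log₂ n ⌉ {{it}} {{>-nonZero (⌈log₂⌉-mono-≤ {2} {n} (nonTrivial⇒n>1 n))}}

    fits : ℕ
    fits = ⌈ length msg / c * ⌈log₂ n ⌉ ⌉ {{capacity≢0}}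

  basicMessages-pos : 1 ≤ basicMessages c n msg
  basicMessages-pos = m≤m⊔n 1 fits

  basicMessages-length : length msg ≤ basicMessages c n msg * (c * ⌈log₂ n ⌉)
  basicMessages-length = ≤-trans (n≤⌈n/b⌉*b (length msg) (c * ⌈log₂ n ⌉) {{capacity≢0}})
    (*-monoˡ-≤ (c * ⌈log₂ n ⌉) (m≤n⊔m 1 fits))

-- Choice of the parameters

record Shape (n m : ℕ) : Set where
  constructor shape
  field
    r h q₁ s : ℕ
    n≡    : n ≡ suc r + (h + r)
    m≡    : m ≡ n * suc q₁ + s
    s<n   : s < n
    h≢0   : 0 < h
    n≤5r  : n ≤ 5 * suc r
    n≤2h  : n ≤ 2 * h

-- Cuts and contested colors compete for agents: `r` is a quarter of `n - 2`, rounded down, and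
-- `h = n - 1 - 2 r` is what remains. Both shares are then linear, also for small `n`: for `n = 2`
-- there is one cut and one far agent.
shapeOf : ∀ n m .{{_ : NonTrivial n}} → n ≤ m → Shape n m
shapeOf n@(2+ k) m n≤m = shape (k / 4) (suc (k ∸ 2 * (k / 4))) (pred (m / n)) (m % n)
  n≡ m≡ (m%n<n m n) (s≤s z≤n) n≤5r n≤2h
  where
  open ≤-Reasoning
  r = k / 4
  4r≤k : r * 4 ≤ k
  4r≤k = m/n*n≤m k 4
  2r+2r≤k : 2 * r + 2 * r ≤ k
  2r+2r≤k = subst (_≤ k) (double r) 4r≤k
    where
    double : ∀ r → r * 4 ≡ 2 * r + 2 * r
    double = solve-∀
  2r≤k : 2 * r ≤ k
  2r≤k = m+n≤o⇒m≤o (2 * r) 2r+2r≤k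
  n≡ : n ≡ suc r + (suc (k ∸ 2 * r) + r)
  n≡ = sym (trans (regroup r (k ∸ 2 * r)) (cong 2+ (m∸n+n≡m 2r≤k)))
    where
    regroup : ∀ r x → suc r + (suc x + r) ≡ 2+ (x + 2 * r)
    regroup = solve-∀
  m≡ : m ≡ n * suc (pred (m / n)) + m % n
  m≡ = begin-equality
    m                                  ≡⟨ m≡m%n+[m/n]*n m n ⟩
    m % n + m / n * n                  ≡⟨ +-comm (m % n) _ ⟩
    m / n * n + m % n                  ≡⟨ cong (_+ m % n) (*-comm (m / n) n) ⟩
    n * (m / n) + m % n                ≡⟨ cong (λ q → n * q + m % n) (suc-pred (m / n) {{>-nonZero (m≥n⇒m/n>0 n≤m)}}) ⟨
    n * suc (pred (m / n)) + m % n     ∎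
  n≤5r : n ≤ 5 * suc r
  n≤5r = begin
    2 + k                    ≡⟨ cong 2+ (m≡m%n+[m/n]*n k 4) ⟩
    2 + (k % 4 + r * 4)      ≤⟨ +-monoʳ-≤ 2 (+-monoˡ-≤ (r * 4) (s≤s⁻¹ (m%n<n k 4))) ⟩
    2 + (3 + r * 4)          ≤⟨ m≤m+n _ r ⟩
    2 + (3 + r * 4) + r      ≡⟨ regroup r ⟩
    5 * suc r                ∎
    where
    regroup : ∀ r → 2 + (3 + r * 4) + r ≡ 5 * suc r
    regroup = solve-∀
  n≤2h : n ≤ 2 * suc (k ∸ 2 * r)
  n≤2h = begin
    2 + k                              ≡⟨ cong 2+ (m∸n+n≡m 2r≤k) ⟨
    2 + (k ∸ 2 * r + 2 * r)            ≤⟨ +-monoʳ-≤ 2 (+-monoʳ-≤ (k ∸ 2 * r) (m+n≤o⇒m≤o∸n (2 * r) 2r+2r≤k)) ⟩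
    2 + (k ∸ 2 * r + (k ∸ 2 * r))      ≡⟨ regroup (k ∸ 2 * r) ⟩
    2 * suc (k ∸ 2 * r)                ∎
    where
    regroup : ∀ x → 2 + (x + x) ≡ 2 * suc x
    regroup = solve-∀

-- The lower bounds

sum-∈ : ∀ {A : Set} (w : A → ℕ) {x xs} → x ∈ xs → w x ≤ sumˡ (List.map w xs)
sum-∈ w (here refl) = m≤m+n _ _
sum-∈ w {x} (there {y} x∈) = ≤-trans (sum-∈ w x∈) (m≤n+m _ (w y))

eventually-nondecreasing : ∀ (f : ℕ → ℕ) → ∃[ a ] f a ≤ f (suc a)
eventually-nondecreasing f = <-rec (λ y → ∀ a → f a ≡ y → ∃[ a ] f a ≤ f (suc a)) search (f 0) 0 refl
  where
  search : ∀ y → (∀ {y′} → y′ < y → ∀ a → f a ≡ y′ → ∃[ a ] f a ≤ f (suc a)) →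
           ∀ a → f a ≡ y → ∃[ a ] f a ≤ f (suc a)
  search y rec a refl with f a ≤? f (suc a)
  ... | yes le = a , le
  ... | no  gt = rec (≰⇒> gt) (suc a) refl

module Setting {n m : ℕ} .{{nt : NonTrivial n}} (S : Shape n m) where
  open Shape S

  p : ℕ
  p = h * suc q₁

  arena : Arena n m p r {{nonTrivial⇒nonZero n}}
  arena = build {{nonTrivial⇒nonZero n}} n≡ m≡ s<n
    where
    build : ∀ {n m} .{{_ : NonZero n}} → n ≡ suc r + (h + r) → m ≡ n * suc q₁ + s → s < n → Arena n m p r
    build refl refl s<n = Blocks.arena r h q₁ s (<⇒≤ s<n) s<n

  p>0 : 0 < p
  p>0 = *-mono-≤ h≢0 (s≤s z≤n)

  m≤4p : m ≤ 4 * p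
  m≤4p = begin
    m                        ≡⟨ m≡ ⟩
    n * suc q₁ + s           ≤⟨ +-monoʳ-≤ (n * suc q₁) (≤-trans (<⇒≤ s<n) (m≤m*n n (suc q₁))) ⟩
    n * suc q₁ + n * suc q₁  ≤⟨ +-mono-≤ (*-monoˡ-≤ (suc q₁) n≤2h) (*-monoˡ-≤ (suc q₁) n≤2h) ⟩
    2 * h * suc q₁ + 2 * h * suc q₁ ≡⟨ regroup h (suc q₁) ⟩
    4 * (h * suc q₁)         ∎
    where
    open ≤-Reasoning
    regroup : ∀ h q → 2 * h * q + 2 * h * q ≡ 4 * (h * q)
    regroup = solve-∀

  r<n : suc r ≤ n
  r<n = subst (suc r ≤_) (sym n≡) (m≤m+n (suc r) (h + r))

  -- The factor is 4 · 5, from m ≤ 4 p and n ≤ 5 (r + 1).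
  share-bound : ∀ {C b cost} → 20 * C * cost < m * n → suc r * b ≤ cost → b * C < p
  share-bound {C} {b} {cost} few share = *-cancelˡ-< (20 * suc r) (b * C) p (begin-strict
    20 * suc r * (b * C)   ≡⟨ regroup (suc r) b C ⟩
    20 * C * (suc r * b)   ≤⟨ *-monoʳ-≤ (20 * C) share ⟩
    20 * C * cost          <⟨ few ⟩
    m * n                  ≤⟨ *-mono-≤ m≤4p n≤5r ⟩
    4 * p * (5 * suc r)    ≡⟨ regroup′ p (suc r) ⟩
    20 * suc r * p         ∎)
    where
    open ≤-Reasoning
    regroup : ∀ r b C → 20 * r * (b * C) ≡ 20 * C * (r * b)
    regroup = solve-∀
    regroup′ : ∀ p r → 4 * p * (5 * r) ≡ 20 * r * p
    regroup′ = solve-∀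

  private instance
    n≢0 : NonZero n
    n≢0 = nonTrivial⇒nonZero n

  module Cuts (c : ℕ) .{{_ : NonZero c}} = Transcripts {n} (basicMessages c n) (c * ⌈log₂ n ⌉)
    (basicMessages-pos c n) (basicMessages-length c n) r (λ l → Crosses {n} (toℕ l)) (λ l → crosses? (toℕ l))
    (λ (i , d) → depth i ⊓ depth (neighbour d i)) (λ {l} {e} → crosses-level {n} {l = toℕ l} {e = e})

-- The asynchronous bound

module _ (c : ℕ) .{{_ : NonZero c}} where

  -- The factor `2 + 2 * c` is the price of a basic message in units of `v` bits: an item takes
  -- `3 + ν + 2 * (c * ν)` bits for each unit of its weight.
  asyncK : ℕ
  asyncK = 20 * (2 + 2 * c)

  async-lower-bound : ∀ {n m} .{{_ : NonTrivial n}} → Shape n m → (A : AsyncAlgorithm n m) →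
                      Async.Solves A → AsyncRequires c asyncK A
  async-lower-bound {n} {m} S A solves = 
    -- The inputs are finitely many and each has a definite stopping time, so it is decidable
    -- whether one of them is expensive. This lets a counting argument by contradiction produce an
    -- input.
    conclude (any? λ z → m * n ≤? asyncK * messagesSent c (run (input z) roundRobin (stop z)))
    where
    open Setting S
    open Shape S using (r)
    instance
      n≢0 : NonZero n
      n≢0 = nonTrivial⇒nonZero n
    open Arena arena
    open Async A
    open AsyncRuns A
    open Cuts c

    ν v : ℕ
    ν = ⌈log₂ n ⌉
    -- The overhead of a key, `2 + ν` bits including the strictness of the bound, is exactly one
    -- unit of `v` bits. The strict inequality `b * (2 + 2 * c) < p` leaves room for it.
    v = 2 + ν

    input : Fin (2 ^ (v * p)) → Instance n m
    input z = contest (amounts v p z) (amounts v p z)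

    -- Minimality carries the bound over to every later complete moment, as the number of messages
    -- never decreases.
    first-stop : ∀ z → ∃[ t ] AllDecided (decisions (run (input z) roundRobin t)) ×
      (∀ u → AllDecided (decisions (run (input z) roundRobin u)) → t ≤ u)
    first-stop z with proj₁ (solves (input z) roundRobin roundRobin-fair)
    ... | t , done with least (λ t → allDecided? (decisions (run (input z) roundRobin t))) t done
    ...   | u , _ , done′ , first = u , done′ , first

    stop : Fin (2 ^ (v * p)) → ℕ
    stop z = proj₁ (first-stop z)

    room : ∀ {b} → b * (2 + 2 * c) < p →
      suc (ν + (0 + suc (b * (3 + 0 + ν + 2 * (c * ν))))) ≤ v * p
    room {b} lt = begin
      suc (ν + (0 + suc (b * (3 + 0 + ν + 2 * (c * ν)))))   ≡⟨ regroup ν _ ⟩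
      2 + ν + b * (3 + ν + 2 * (c * ν))                     ≤⟨ +-monoʳ-≤ v (*-monoʳ-≤ b width) ⟩
      v + b * (v * (2 + 2 * c))                             ≡⟨ factor v b (2 + 2 * c) ⟩
      v * suc (b * (2 + 2 * c))                             ≤⟨ *-monoʳ-≤ v lt ⟩
      v * p                                                 ∎
      where
      open ≤-Reasoning
      regroup : ∀ ν x → suc (ν + (0 + suc x)) ≡ 2 + ν + x
      regroup = solve-∀
      width : 3 + ν + 2 * (c * ν) ≤ v * (2 + 2 * c)
      width = ≤-trans (m≤m+n _ (1 + ν + 4 * c)) (≤-reflexive (expand c ν))
        where
        expand : ∀ c ν → 3 + ν + 2 * (c * ν) + (1 + ν + 4 * c) ≡ (2 + ν) * (2 + 2 * c)
        expand = solve-∀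
      factor : ∀ v b C → v + b * (v * C) ≡ v * suc (b * C)
      factor = solve-∀

    finite-events : Fin (2 ^ (v * p)) → List (Item n)
    finite-events z = events (input z) roundRobin (stop z)

    fooled : ∀ z z′ {k} l → amounts v p z k < amounts v p z′ k →
             crossing l (finite-events z) ≢ crossing l (finite-events z′)
    fooled z z′ {k} l lt = async-fooled A arena solves
      {amounts v p z} {amounts v p z′} {k} {toℕ l} {stop z} {stop z′}
      (s≤s⁻¹ (toℕ<n l)) lt
      (proj₁ (proj₂ (first-stop z))) (proj₁ (proj₂ (first-stop z′)))

    no-collision : ¬ (∃₂ λ z z′ → z ≢ z′ × 0 ≡ 0 × (∃[ l ] crossing l (finite-events z) ≡ crossing l (finite-events z′)))
    no-collision (z , z′ , z≢z′ , _ , l , same) with amounts-differ v p z≢z′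
    -- A collision is symmetric; the input with fewer items at `k` takes the part of the owners.
    ... | k , differ with <-cmp (amounts v p z k) (amounts v p z′ k)
    ...   | tri< lt _ _ = fooled z z′ l lt same
    ...   | tri≈ _ eq _ = differ eq
    ...   | tri> _ _ gt = fooled z′ z l gt (sym same)

    conclude : Dec (∃[ z ] m * n ≤ asyncK * messagesSent c (run (input z) roundRobin (stop z))) →
               AsyncRequires c asyncK A
    conclude (yes (z , le)) = input z , roundRobin , roundRobin-fair , λ t done →
      ≤-trans le (*-monoʳ-≤ asyncK (messagesSent-mono c (input z) roundRobin (proj₂ (proj₂ (first-stop z)) t done)))
    conclude (no cheap) = ⊥-elim (no-collision (transcripts-collide ν 0 (n≤2^⌈log₂n⌉ n) (≤-trans r<n (n≤2^⌈log₂n⌉ n))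
      finite-events (λ _ → 0) (λ z → events-timely (input z) roundRobin (stop z)) (λ _ → s≤s z≤n) small))
      where
      small : ∀ z b → suc r * b ≤ cost-of (finite-events z) →
              suc (ν + (0 + suc (b * (3 + 0 + ν + 2 * (c * ν))))) ≤ v * p
      small z b share = room {b} (share-bound {2 + 2 * c} {b} (≰⇒> λ le → cheap (z , le))
        (≤-trans share (events-cost c (input z) roundRobin (stop z))))

-- The synchronous bound

module _ {n m : ℕ} .{{_ : NonTrivial n}} (c : ℕ) .{{_ : NonZero c}} (A : SyncAlgorithm n m) where
  open Sync A
  open SyncRuns A

  silent : ∀ {Q t} → ¬ (1 ≤ messagesSent c Q t) → ∀ {s i d} → s < t → sent (run Q (suc s)) i d ≡ nothing
  silent {Q} {t} none {s} {i} {d} s<t with sent (run Q (suc s)) i d in eq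
  ... | nothing  = refl
  ... | just msg = contradiction (begin
    1
      ≤⟨ basicMessages-pos c n msg ⟩
    basicMessages c n msg
      ≤⟨ sum-∈ (λ (_ , _ , msg) → basicMessages c n msg) (∈-events Q s<t eq) ⟩
    sumˡ (List.map (λ (_ , _ , msg) → basicMessages c n msg) (events Q t))
      ≡⟨ events-cost c Q t ⟩
    messagesSent c Q t ∎) none
    where open ≤-Reasoning

  module Stopping {d : ℕ} (solves : SolvesInTime d) (Q : Instance n m) where

    private
      first : ∃[ u ] u ≤ proj₁ (proj₁ (solves Q)) × AllDecided (decisions (run Q u)) ×
              (∀ t → AllDecided (decisions (run Q t)) → u ≤ t)
      first = least (λ t → allDecided? (decisions (run Q t))) (proj₁ (proj₁ (solves Q))) (proj₂ (proj₂ (proj₁ (solves Q))))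

    halt : ℕ
    halt = proj₁ first

    halt-≤ : halt ≤ (n + m + totalItems Q) ^ d
    halt-≤ = ≤-trans (proj₁ (proj₂ first)) (proj₁ (proj₂ (proj₁ (solves Q))))

    halt-done : AllDecided (decisions (run Q halt))
    halt-done = proj₁ (proj₂ (proj₂ first))

    halt-enough : ∀ K → m * n ≤ K * messagesSent c Q halt → SyncRequires c K A
    halt-enough K le = Q , λ t done → ≤-trans le (*-monoʳ-≤ K
      (messagesSent-mono c Q (proj₂ (proj₂ (proj₂ first)) t done)))

module _ (c : ℕ) .{{_ : NonZero c}} (d : ℕ) where

  -- In `manyK` the factor 2 reserves half of `p` for the overhead of `2 + 5 * d` units, which fits
  -- if `4 + 10 * d ≤ p`. Otherwise `m ≤ 4 * p` bounds both `m` and `n`, and `fewK` bounds their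
  -- product.
  manyK fewK syncK : ℕ
  manyK = 20 * (2 * (2 + 5 * d + 2 * c))
  fewK  = 4 * (4 + 10 * d) * (4 * (4 + 10 * d))
  syncK = manyK + fewK

  module _ {n m : ℕ} .{{_ : NonTrivial n}} (n≤m : n ≤ m) (S : Shape n m) (A : SyncAlgorithm n m)
    (solves : Sync.SolvesInTime A d) where

    private instance
      n≢0 : NonZero n
      n≢0 = nonTrivial⇒nonZero n

    open Setting S
    open Shape S using (r)
    open Arena arena
    open Sync A
    open SyncRuns A
    open Stopping c A {d} solves

    private
      flat : ℕ → Instance n m
      flat a = contest (const a) (const a)

    -- With the stopping time, the code of a transcript takes about 5 d v more bits,
    -- which do not fit into v p if there are few colors. But then it suffices that
    -- some message is sent: otherwise the owners for α = a, if they stop no later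
    -- than those for α = a + 1, cannot tell whether agent 0 holds a or a + 1, and
    -- the stopping time cannot decrease forever in a.
    few-colors : p < 4 + 10 * d → SyncRequires c syncK A
    few-colors p< with eventually-nondecreasing (λ a → halt (flat a))
    ... | a , t≤t′ = cases (1 ≤? messagesSent c (flat a) (halt (flat a)))
                           (1 ≤? messagesSent c (flat (suc a)) (halt (flat (suc a))))
      where
      enough : m * n ≤ fewK
      enough = *-mono-≤ m≤ (≤-trans n≤m m≤)
        where
        m≤ : m ≤ 4 * (4 + 10 * d)
        m≤ = ≤-trans m≤4p (*-monoʳ-≤ 4 (<⇒≤ p<))

      one-suffices : ∀ Q → 1 ≤ messagesSent c Q (halt Q) → SyncRequires c syncK A
      one-suffices Q pos = halt-enough Q syncK (≤-trans enough (≤-trans (m≤n+m fewK manyK)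
        (m≤m*n syncK (messagesSent c Q (halt Q)) {{>-nonZero pos}})))

      cases : Dec (1 ≤ messagesSent c (flat a) (halt (flat a))) →
              Dec (1 ≤ messagesSent c (flat (suc a)) (halt (flat (suc a)))) → SyncRequires c syncK A
      cases (yes pos) _         = one-suffices (flat a) pos
      cases (no _)    (yes pos) = one-suffices (flat (suc a)) pos
      -- Without any messages every cut will do, and level 0 always exists. Silence is needed only
      -- up to the earlier stopping time.
      cases (no none) (no none′) = ⊥-elim (sync-fooled A arena {d} solves {const a} {const (suc a)} {k₀} {0} {halt (flat a)}
        z≤n (n<1+n a) (halt-done (flat a))
        λ s<t _ → trans (silent c A none s<t) (sym (silent c A none′ (<-≤-trans s<t t≤t′))))
        where
        k₀ : Fin p
        k₀ = fromℕ< p>0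

    private
      ν v k : ℕ
      ν = ⌈log₂ n ⌉
      -- The logarithm is that of `m`, because the running time may be polynomial in `m`; as
      -- `n ≤ m`, it covers `ν` too.
      v = 2 + ⌈log₂ m ⌉
      -- The size of an input is at most `2 ^ (5 * v)`: the items contribute at most
      -- `2 * 2 ^ (3 * v)`, and the rest is slack. The `suc` makes the bound on the stopping time
      -- strict.
      k = suc (5 * v * d)

      input : Fin (2 ^ (v * p)) → Instance n m
      input z = contest (amounts v p z) (amounts v p z)

      m≤2^v : m ≤ 2 ^ v
      m≤2^v = ≤-trans (n≤2^⌈log₂n⌉ m) (^-monoʳ-≤ 2 (m≤n+m ⌈log₂ m ⌉ 2))

      size≤ : ∀ z → n + m + totalItems (input z) ≤ 2 ^ (5 * v)
      size≤ z = begin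
        n + m + totalItems (input z)
          ≤⟨ +-monoʳ-≤ (n + m) (total-contest (amounts-bounded v p z)) ⟩
        n + m + m * (n * (2 * pred V + 2))
          ≡⟨ cong (λ x → n + m + m * (n * x)) (trans (+-comm (2 * pred V) 2)
               (trans (sym (*-suc 2 (pred V))) (cong (2 *_) (suc-pred V {{m^n≢0 2 v}})))) ⟩
        n + m + m * (n * (2 * V))
          ≤⟨ +-mono-≤ (+-mono-≤ n≤V m≤2^v) (*-mono-≤ m≤2^v (*-monoˡ-≤ (2 * V) n≤V)) ⟩
        V + V + V * (V * (2 * V))
          ≡⟨ regroup V ⟩
        2 * V * (1 * 1) + 2 * V * (V * V)
          ≤⟨ +-monoˡ-≤ (2 * V * (V * V)) (*-monoʳ-≤ (2 * V) (*-mono-≤ V≥1 V≥1)) ⟩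
        2 * V * (V * V) + 2 * V * (V * V)
          ≡⟨ regroup′ V ⟩
        2 * 2 * (V * (V * V))
          ≤⟨ *-monoˡ-≤ (V * (V * V)) (*-mono-≤ V≥2 V≥2) ⟩
        V * V * (V * (V * V))
          ≡⟨ fifth V ⟩
        V ^ 5
          ≡⟨ trans (^-*-assoc 2 v 5) (cong (2 ^_) (*-comm v 5)) ⟩
        2 ^ (5 * v) ∎
        where
        open ≤-Reasoning
        V : ℕ
        V = 2 ^ v
        n≤V : n ≤ V
        n≤V = ≤-trans n≤m m≤2^v
        V≥2 : 2 ≤ V
        V≥2 = ^-monoʳ-≤ 2 {1} {v} (s≤s z≤n)
        V≥1 : 1 ≤ V
        V≥1 = ≤-trans (s≤s z≤n) V≥2
        regroup : ∀ V → V + V + V * (V * (2 * V)) ≡ 2 * V * (1 * 1) + 2 * V * (V * V)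
        regroup = solve-∀
        regroup′ : ∀ V → 2 * V * (V * V) + 2 * V * (V * V) ≡ 2 * 2 * (V * (V * V))
        regroup′ = solve-∀
        fifth : ∀ V → V * V * (V * (V * V)) ≡ V * (V * (V * (V * (V * 1))))
        fifth = solve-∀

      halt< : ∀ z → halt (input z) < 2 ^ k
      halt< z = begin-strict
        halt (input z)                         ≤⟨ halt-≤ (input z) ⟩
        (n + m + totalItems (input z)) ^ d     ≤⟨ ^-monoˡ-≤ d (size≤ z) ⟩
        (2 ^ (5 * v)) ^ d                      ≡⟨ ^-*-assoc 2 (5 * v) d ⟩
        2 ^ (5 * v * d)                        <⟨ ^-monoʳ-< 2 (s≤s (s≤s z≤n)) (n<1+n (5 * v * d)) ⟩
        2 ^ k                                  ∎
        where open ≤-Reasoning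

      open Cuts c

      finite-events : Fin (2 ^ (v * p)) → List (Item n)
      finite-events z = events (input z) (halt (input z))

      fooled : ∀ z z′ {k} l → amounts v p z k < amounts v p z′ k → halt (input z) ≡ halt (input z′) →
               crossing l (finite-events z) ≢ crossing l (finite-events z′)
      fooled z z′ {k} l lt t≡t′ same = sync-fooled A arena {d} solves
        {amounts v p z} {amounts v p z′} {k} {toℕ l} {halt (input z)} (s≤s⁻¹ (toℕ<n l)) lt (halt-done (input z))
        -- With equal stopping times both traces cover the same rounds, so an item missing from one
        -- means silence rather than an early end.
        (traces-agree (toℕ l) (halt (input z)) (input z) (input z′)
          (trans same (cong (λ t → crossing l (events (input z′) t)) (sym t≡t′))))

      no-collision : ¬ (∃₂ λ z z′ → z ≢ z′ × halt (input z) ≡ halt (input z′) ×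
                        (∃[ l ] crossing l (finite-events z) ≡ crossing l (finite-events z′)))
      no-collision (z , z′ , z≢z′ , t≡t′ , l , same) with amounts-differ v p z≢z′
      ... | k , differ with <-cmp (amounts v p z k) (amounts v p z′ k)
      ...   | tri< lt _ _ = fooled z z′ l lt t≡t′ same
      ...   | tri≈ _ eq _ = differ eq
      ...   | tri> _ _ gt = fooled z′ z l gt (sym t≡t′) (sym same)

      room : ∀ {b} → 4 + 10 * d ≤ p → b * (2 * (2 + 5 * d + 2 * c)) < p →
        suc (ν + (k + suc (b * (3 + k + ν + 2 * (c * ν))))) ≤ v * p
      room {b} many lt = begin
        suc (ν + (k + suc (b * (3 + k + ν + 2 * (c * ν)))))
          ≤⟨ s≤s (+-mono-≤ ν≤μ (+-monoʳ-≤ k (s≤s (*-monoʳ-≤ b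
               (+-mono-≤ (+-monoʳ-≤ (3 + k) ν≤μ) (*-monoʳ-≤ 2 (*-monoʳ-≤ c ν≤μ))))))) ⟩
        suc (μ + (k + suc (b * (3 + k + μ + 2 * (c * μ)))))
          ≤⟨ m≤m+n _ (1 + μ + b * (μ + 4 * c)) ⟩
        suc (μ + (k + suc (b * (3 + k + μ + 2 * (c * μ))))) + (1 + μ + b * (μ + 4 * c))
          ≡⟨ widen μ d b c ⟩
        v * (2 + 5 * d + b * (2 + 5 * d + 2 * c))
          ≤⟨ *-monoʳ-≤ v (*-cancelˡ-≤ {2 + 5 * d + b * (2 + 5 * d + 2 * c)} {p} 2 halves) ⟩
        v * p ∎
        where
        open ≤-Reasoning
        μ : ℕ
        μ = ⌈log₂ m ⌉
        ν≤μ : ν ≤ μ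
        ν≤μ = ⌈log₂⌉-mono-≤ n≤m
        widen : ∀ μ d b c →
          suc (μ + (suc (5 * (2 + μ) * d) + suc (b * (3 + suc (5 * (2 + μ) * d) + μ + 2 * (c * μ))))) +
            (1 + μ + b * (μ + 4 * c)) ≡
          (2 + μ) * (2 + 5 * d + b * (2 + 5 * d + 2 * c))
        widen = solve-∀
        halves : 2 * (2 + 5 * d + b * (2 + 5 * d + 2 * c)) ≤ 2 * p
        halves = begin
          2 * (2 + 5 * d + b * (2 + 5 * d + 2 * c))             ≡⟨ double d b (2 + 5 * d + 2 * c) ⟩
          4 + 10 * d + b * (2 * (2 + 5 * d + 2 * c))            ≤⟨ +-mono-≤ many (<⇒≤ lt) ⟩
          p + p                                                 ≡⟨ cong (p +_) (+-identityʳ p) ⟨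
          2 * p                                                 ∎
          where
          double : ∀ d b C → 2 * (2 + 5 * d + b * C) ≡ 4 + 10 * d + b * (2 * C)
          double = solve-∀

    many-colors : 4 + 10 * d ≤ p → SyncRequires c syncK A
    many-colors many = conclude (any? λ z → m * n ≤? manyK * messagesSent c (input z) (halt (input z)))
      where
      conclude : Dec (∃[ z ] m * n ≤ manyK * messagesSent c (input z) (halt (input z))) → SyncRequires c syncK A
      conclude (yes (z , le)) = halt-enough (input z) syncK
        (≤-trans le (*-monoˡ-≤ (messagesSent c (input z) (halt (input z))) (m≤m+n manyK fewK)))
      conclude (no cheap) = ⊥-elim (no-collision (transcripts-collide ν k (n≤2^⌈log₂n⌉ n) (≤-trans r<n (n≤2^⌈log₂n⌉ n))
        finite-events (λ z → halt (input z))
        (λ z → All.map (λ s<t → <-trans s<t (halt< z)) (events-timely (input z) (halt (input z)))) halt< small))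
        where
        small : ∀ z b → suc r * b ≤ cost-of (finite-events z) →
                suc (ν + (k + suc (b * (3 + k + ν + 2 * (c * ν))))) ≤ v * p
        small z b share = room {b} many (share-bound {2 * (2 + 5 * d + 2 * c)} {b} (≰⇒> λ le → cheap (z , le))
          (≤-trans share (≤-reflexive (events-cost c (input z) (halt (input z))))))

    sync-lower-bound : SyncRequires c syncK A
    sync-lower-bound with 4 + 10 * d ≤? p
    ... | yes many = many-colors many
    ... | no  few  = few-colors (≰⇒> few)

theorem11 : (c : ℕ) .{{_ : NonZero c}} →
    ((d : ℕ) → ∃[ K ] ((n m : ℕ) .{{_ : NonTrivial n}} → n ≤ m →
    (A : SyncAlgorithm n m) → Sync.SolvesInTime A d → SyncRequires c K A))
    ×
    (∃[ K ] ((n m : ℕ) .{{_ : NonTrivial n}} → n ≤ m →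
    (A : AsyncAlgorithm n m) → Async.Solves A → AsyncRequires c K A))
theorem11 c =
  (λ d → syncK c d , λ n m n≤m A solves → sync-lower-bound c d n≤m (shapeOf n m n≤m) A solves) ,
  (asyncK c , λ n m n≤m A solves → async-lower-bound c (shapeOf n m n≤m) A solves)
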